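{- If $T$ is a weighted tree, then its subdivision $S(T)$ does not admit $\epsilon$-uniform mixing relative to its (weighted) adjacency matrix.
   Context: The subdivision $S(X)$ of a graph $X$ is obtained from $X$ by replacing each edge $\{u,v\}$ of $X$ by two edges $\{u,w\}$ and $\{w,v\}$, where $w$ is a new vertex (one new vertex for each edge). The edges of $S(T)$ may carry any assignment of positive weights. For a weighted graph on $N$ vertices with weighted adjacency matrix $A$, put $U(t)=e^{\mathrm{i}tA}$; $\mathbf{e}_u$ is the characteristic vector of $u$, $\mathbf{1}$ the all-ones vector, $\circ$ the entrywise product. $\epsilon$-uniform mixing occurs if for each $\epsilon>0$ there is a $\tau\in\mathbb{R}$ such that $\big\|(U(\tau)\mathbf{e}_u)\circ(\overline{U(\tau)}\mathbf{e}_u)-\tfrac1N\mathbf{1}\big\|<\epsilon$ simultaneously for all vertices $u$.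
   Formalization: The tree T is assumed to have at least two vertices: for the one-vertex tree, S(T) is a single vertex, U(t) = (1), and uniform mixing holds trivially, so the claim fails there. -}

module Defs where

open import Data.Bool.Base using (if_then_else_)
open import Data.Fin.Base using (Fin; zero; suc; toℕ; fromℕ; inject₁; _↑ˡ_; _↑ʳ_; splitAt; join)
import Data.Fin.Properties as Fin
import Data.Integer.Base as ℤ
open import Data.Nat.Base as ℕ using (ℕ; zero; suc; _!)
import Data.Nat.Properties as ℕ
open import Data.Product using (Σ; ∃-syntax; _×_; _,_)
open import Data.Rational.Base as ℚ using (ℚ; 0ℚ; 1ℚ; ½)
import Data.Rational.Properties as ℚ
open import Data.Sum.Base using (_⊎_; inj₁; inj₂; [_,_]′)
open import Data.Vec.Functional using (Vector; foldr)
open import Function.Definitions using (Injective)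
open import Relation.Binary.Construct.Closure.ReflexiveTransitive using (Star)
open import Relation.Binary.PropositionalEquality
open import Relation.Nullary using (¬_; Dec; does; contradiction)
open import Relation.Nullary.Decidable using (_×-dec_; _⊎-dec_; dec⇒maybe)
open import Tactic.RingSolver using (solve-∀)
open import Tactic.RingSolver.Core.AlmostCommutativeRing using (AlmostCommutativeRing; fromCommutativeRing)

-- Real numbers: Cauchy sequences of rationals, with the setoid equality
-- _≈_ and pointwise arithmetic.

Eventually : (ℕ → Set) → Set
Eventually P = ∃[ N ] (∀ n → N ℕ.≤ n → P n)

Cauchy : (ℕ → ℚ) → Set
Cauchy x = ∀ (ε : ℚ) → 0ℚ ℚ.< ε →
  ∃[ N ] (∀ m n → N ℕ.≤ m → N ℕ.≤ n → ℚ.∣ x m ℚ.- x n ∣ ℚ.≤ ε)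

record ℝ : Set where
  constructor mkℝ
  field
    seq    : ℕ → ℚ
    cauchy : Cauchy seq

open ℝ public

infix 4 _≈_ _<_ _≤_

_≈_ : ℝ → ℝ → Set
x ≈ y = ∀ (ε : ℚ) → 0ℚ ℚ.< ε → Eventually λ n → ℚ.∣ seq x n ℚ.- seq y n ∣ ℚ.≤ ε

_<_ : ℝ → ℝ → Set
x < y = ∃[ ε ] (0ℚ ℚ.< ε × Eventually λ n → seq x n ℚ.+ ε ℚ.≤ seq y n)

_≤_ : ℝ → ℝ → Set
x ≤ y = ∀ (ε : ℚ) → 0ℚ ℚ.< ε → Eventually λ n → seq x n ℚ.≤ seq y n ℚ.+ ε

private
  ℚ-ring : AlmostCommutativeRing _ _
  ℚ-ring = fromCommutativeRing ℚ.+-*-commutativeRing (λ q → dec⇒maybe (0ℚ ℚ.≟ q))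

  half-pos : ∀ {ε} → 0ℚ ℚ.< ε → 0ℚ ℚ.< ½ ℚ.* ε
  half-pos {ε} 0<ε = subst (ℚ._< ½ ℚ.* ε) (ℚ.*-zeroʳ ½) (ℚ.*-monoʳ-<-pos ½ 0<ε)

  half+half : ∀ ε → ½ ℚ.* ε ℚ.+ ½ ℚ.* ε ≡ ε
  half+half ε = trans (sym (ℚ.*-distribʳ-+ ε ½ ½)) (ℚ.*-identityˡ ε)

  const-cauchy : ∀ q → Cauchy (λ _ → q)
  const-cauchy q ε 0<ε = 0 , λ _ _ _ _ →
    subst (λ z → ℚ.∣ z ∣ ℚ.≤ ε) (sym (ℚ.+-inverseʳ q)) (ℚ.<⇒≤ 0<ε)

  +-cauchy : ∀ x y → Cauchy x → Cauchy y → Cauchy (λ n → x n ℚ.+ y n)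
  +-cauchy x y cx cy ε 0<ε
    with M , hM ← cx (½ ℚ.* ε) (half-pos 0<ε)
       | N , hN ← cy (½ ℚ.* ε) (half-pos 0<ε) =
    M ℕ.⊔ N , λ m n Km Kn → begin
      ℚ.∣ (x m ℚ.+ y m) ℚ.- (x n ℚ.+ y n) ∣
        ≡⟨ cong ℚ.∣_∣ (regroup (x m) (y m) (x n) (y n)) ⟩
      ℚ.∣ (x m ℚ.- x n) ℚ.+ (y m ℚ.- y n) ∣
        ≤⟨ ℚ.∣p+q∣≤∣p∣+∣q∣ (x m ℚ.- x n) (y m ℚ.- y n) ⟩
      ℚ.∣ x m ℚ.- x n ∣ ℚ.+ ℚ.∣ y m ℚ.- y n ∣
        ≤⟨ ℚ.+-mono-≤
             (hM m n (ℕ.m⊔n≤o⇒m≤o M N Km) (ℕ.m⊔n≤o⇒m≤o M N Kn))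
             (hN m n (ℕ.m⊔n≤o⇒n≤o M N Km) (ℕ.m⊔n≤o⇒n≤o M N Kn)) ⟩
      ½ ℚ.* ε ℚ.+ ½ ℚ.* ε
        ≡⟨ half+half ε ⟩
      ε ∎
    where
    open ℚ.≤-Reasoning
    regroup : ∀ a b c d → (a ℚ.+ b) ℚ.- (c ℚ.+ d) ≡ (a ℚ.- c) ℚ.+ (b ℚ.- d)
    regroup = solve-∀ ℚ-ring

  neg-cauchy : ∀ x → Cauchy x → Cauchy (λ n → ℚ.- x n)
  neg-cauchy x cx ε 0<ε with N , hN ← cx ε 0<ε =
    N , λ m n Nm Nn → subst (ℚ._≤ ε)
      (trans (sym (ℚ.∣-p∣≡∣p∣ (x m ℚ.- x n))) (cong ℚ.∣_∣ (ℚ.neg-distrib-+ (x m) (ℚ.- x n))))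
      (hN m n Nm Nn)

  0<1+q : ∀ q → 0ℚ ℚ.≤ q → 0ℚ ℚ.< 1ℚ ℚ.+ q
  0<1+q q 0≤q = ℚ.<-≤-trans (ℚ.positive⁻¹ 1ℚ)
    (subst (ℚ._≤ 1ℚ ℚ.+ q) (ℚ.+-identityʳ 1ℚ) (ℚ.+-monoʳ-≤ 1ℚ 0≤q))

  bounded : ∀ x → Cauchy x →
            ∃[ B ] (0ℚ ℚ.< B × Eventually λ n → ℚ.∣ x n ∣ ℚ.≤ B)
  bounded x cx with N , hN ← cx 1ℚ (ℚ.positive⁻¹ 1ℚ) =
    1ℚ ℚ.+ ℚ.∣ x N ∣ , 0<1+q ℚ.∣ x N ∣ (ℚ.0≤∣p∣ (x N)) , N , λ n Nn → begin
      ℚ.∣ x n ∣                       ≡⟨ cong ℚ.∣_∣ (split (x n) (x N)) ⟩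
      ℚ.∣ (x n ℚ.- x N) ℚ.+ x N ∣     ≤⟨ ℚ.∣p+q∣≤∣p∣+∣q∣ (x n ℚ.- x N) (x N) ⟩
      ℚ.∣ x n ℚ.- x N ∣ ℚ.+ ℚ.∣ x N ∣ ≤⟨ ℚ.+-monoˡ-≤ ℚ.∣ x N ∣ (hN n N Nn ℕ.≤-refl) ⟩
      1ℚ ℚ.+ ℚ.∣ x N ∣                ∎
    where
    open ℚ.≤-Reasoning
    split : ∀ a b → a ≡ (a ℚ.- b) ℚ.+ b
    split = solve-∀ ℚ-ring

  shrink : ∀ {B ε} → 0ℚ ℚ.< B → 0ℚ ℚ.< ε → ∃[ δ ] (0ℚ ℚ.< δ × B ℚ.* δ ≡ ε)
  shrink {B} {ε} 0<B 0<ε = ℚ.1/ B ℚ.* ε , δ-pos , eq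
    where
    instance
      B-pos : ℚ.Positive B
      B-pos = ℚ.positive 0<B
      B≢0 : ℚ.NonZero B
      B≢0 = ℚ.pos⇒nonZero B
      1/B-pos : ℚ.Positive (ℚ.1/ B)
      1/B-pos = ℚ.1/pos⇒pos B
    δ-pos : 0ℚ ℚ.< ℚ.1/ B ℚ.* ε
    δ-pos = subst (ℚ._< ℚ.1/ B ℚ.* ε) (ℚ.*-zeroʳ (ℚ.1/ B)) (ℚ.*-monoʳ-<-pos (ℚ.1/ B) 0<ε)
    eq : B ℚ.* (ℚ.1/ B ℚ.* ε) ≡ ε
    eq = trans (sym (ℚ.*-assoc B (ℚ.1/ B) ε))
               (trans (cong (ℚ._* ε) (ℚ.*-inverseʳ B)) (ℚ.*-identityˡ ε))

  *-bound : ∀ {B δ} p q → 0ℚ ℚ.< B → ℚ.∣ p ∣ ℚ.≤ B → ℚ.∣ q ∣ ℚ.≤ δ →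
            ℚ.∣ p ℚ.* q ∣ ℚ.≤ B ℚ.* δ
  *-bound {B} {δ} p q 0<B hp hq = begin
    ℚ.∣ p ℚ.* q ∣         ≡⟨ ℚ.∣p*q∣≡∣p∣*∣q∣ p q ⟩
    ℚ.∣ p ∣ ℚ.* ℚ.∣ q ∣   ≤⟨ ℚ.*-monoʳ-≤-nonNeg ℚ.∣ q ∣ {{ℚ.∣-∣-nonNeg q}} hp ⟩
    B ℚ.* ℚ.∣ q ∣         ≤⟨ ℚ.*-monoˡ-≤-nonNeg B {{ℚ.nonNegative (ℚ.<⇒≤ 0<B)}} hq ⟩
    B ℚ.* δ               ∎
    where open ℚ.≤-Reasoning

  *-regroup : ∀ a b c d → a ℚ.* b ℚ.- c ℚ.* d ≡ a ℚ.* (b ℚ.- d) ℚ.+ d ℚ.* (a ℚ.- c)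
  *-regroup = solve-∀ ℚ-ring

  *-close : ∀ {B C δ η ε} a b c d → 0ℚ ℚ.< B → 0ℚ ℚ.< C →
            B ℚ.* δ ≡ ½ ℚ.* ε → C ℚ.* η ≡ ½ ℚ.* ε →
            ℚ.∣ a ∣ ℚ.≤ B → ℚ.∣ d ∣ ℚ.≤ C →
            ℚ.∣ b ℚ.- d ∣ ℚ.≤ δ → ℚ.∣ a ℚ.- c ∣ ℚ.≤ η →
            ℚ.∣ a ℚ.* b ℚ.- c ℚ.* d ∣ ℚ.≤ ε
  *-close {B} {C} {δ} {η} {ε} a b c d 0<B 0<C Bδ≡ Cη≡ ha hd hbd hac = begin
    ℚ.∣ a ℚ.* b ℚ.- c ℚ.* d ∣
      ≡⟨ cong ℚ.∣_∣ (*-regroup a b c d) ⟩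
    ℚ.∣ a ℚ.* (b ℚ.- d) ℚ.+ d ℚ.* (a ℚ.- c) ∣
      ≤⟨ ℚ.∣p+q∣≤∣p∣+∣q∣ (a ℚ.* (b ℚ.- d)) (d ℚ.* (a ℚ.- c)) ⟩
    ℚ.∣ a ℚ.* (b ℚ.- d) ∣ ℚ.+ ℚ.∣ d ℚ.* (a ℚ.- c) ∣
      ≤⟨ ℚ.+-mono-≤ (*-bound a (b ℚ.- d) 0<B ha hbd) (*-bound d (a ℚ.- c) 0<C hd hac) ⟩
    B ℚ.* δ ℚ.+ C ℚ.* η
      ≡⟨ cong₂ ℚ._+_ Bδ≡ Cη≡ ⟩
    ½ ℚ.* ε ℚ.+ ½ ℚ.* ε
      ≡⟨ half+half ε ⟩
    ε ∎
    where open ℚ.≤-Reasoning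

  *-cauchy : ∀ x y → Cauchy x → Cauchy y → Cauchy (λ n → x n ℚ.* y n)
  *-cauchy x y cx cy ε 0<ε =
    let B , 0<B , K , hK = bounded x cx
        C , 0<C , L , hL = bounded y cy
        δ , 0<δ , Bδ≡ = shrink 0<B (half-pos 0<ε)
        η , 0<η , Cη≡ = shrink 0<C (half-pos 0<ε)
        M , hM = cx η 0<η
        N , hN = cy δ 0<δ
    in (K ℕ.⊔ L) ℕ.⊔ (M ℕ.⊔ N) , λ m n hm hn →
      let KL≤m = ℕ.m⊔n≤o⇒m≤o (K ℕ.⊔ L) (M ℕ.⊔ N) hm
          KL≤n = ℕ.m⊔n≤o⇒m≤o (K ℕ.⊔ L) (M ℕ.⊔ N) hn
          MN≤m = ℕ.m⊔n≤o⇒n≤o (K ℕ.⊔ L) (M ℕ.⊔ N) hm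
          MN≤n = ℕ.m⊔n≤o⇒n≤o (K ℕ.⊔ L) (M ℕ.⊔ N) hn
      in *-close (x m) (y m) (x n) (y n) 0<B 0<C Bδ≡ Cη≡
           (hK m (ℕ.m⊔n≤o⇒m≤o K L KL≤m))
           (hL n (ℕ.m⊔n≤o⇒n≤o K L KL≤n))
           (hN m n (ℕ.m⊔n≤o⇒n≤o M N MN≤m) (ℕ.m⊔n≤o⇒n≤o M N MN≤n))
           (hM m n (ℕ.m⊔n≤o⇒m≤o M N MN≤m) (ℕ.m⊔n≤o⇒m≤o M N MN≤n))

infixl 6 _+_ _-_
infixl 7 _*_
infix  8 -_

fromℚ : ℚ → ℝ
fromℚ q = mkℝ (λ _ → q) (const-cauchy q)

0ℝ 1ℝ : ℝ
0ℝ = fromℚ 0ℚ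
1ℝ = fromℚ 1ℚ

_+_ : ℝ → ℝ → ℝ
mkℝ x cx + mkℝ y cy = mkℝ (λ n → x n ℚ.+ y n) (+-cauchy x y cx cy)

_*_ : ℝ → ℝ → ℝ
mkℝ x cx * mkℝ y cy = mkℝ (λ n → x n ℚ.* y n) (*-cauchy x y cx cy)

-_ : ℝ → ℝ
- mkℝ x cx = mkℝ (λ n → ℚ.- x n) (neg-cauchy x cx)

_-_ : ℝ → ℝ → ℝ
x - y = x + (- y)

recip : (n : ℕ) .{{_ : ℕ.NonZero n}} → ℝ
recip n = fromℚ (ℤ.+ 1 ℚ./ n)

sumℝ : ∀ {n} → Vector ℝ n → ℝ
sumℝ = foldr _+_ 0ℝ

_⟶_ : (ℕ → ℝ) → ℝ → Set
x ⟶ l = ∀ (ε : ℝ) → 0ℝ < ε → Eventually λ n → (l - ε < x n) × (x n < l + ε)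

record ℂ : Set where
  constructor _+i_
  field
    re im : ℝ

open ℂ public

ofℝ : ℝ → ℂ
ofℝ x = x +i 0ℝ

0ℂ 1ℂ iℂ : ℂ
0ℂ = ofℝ 0ℝ
1ℂ = ofℝ 1ℝ
iℂ = 0ℝ +i 1ℝ

infixl 6 _+ᶜ_ _-ᶜ_
infixl 7 _*ᶜ_

_+ᶜ_ _-ᶜ_ _*ᶜ_ : ℂ → ℂ → ℂ
(a +i b) +ᶜ (c +i d) = (a + c) +i (b + d)
(a +i b) -ᶜ (c +i d) = (a - c) +i (b - d)
(a +i b) *ᶜ (c +i d) = (a * c - b * d) +i (a * d + b * c)

conj : ℂ → ℂ
conj (a +i b) = a +i (- b)

∣_∣² : ℂ → ℝ
∣ a +i b ∣² = a * a + b * b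

sumℂ : ∀ {n} → Vector ℂ n → ℂ
sumℂ = foldr _+ᶜ_ 0ℂ

_⟶ᶜ_ : (ℕ → ℂ) → ℂ → Set
z ⟶ᶜ l = ((λ n → re (z n)) ⟶ re l) × ((λ n → im (z n)) ⟶ im l)

Matrix : Set → ℕ → Set
Matrix K n = Fin n → Fin n → K

private variable
  n : ℕ

δ : Fin n → Fin n → ℂ
δ u v = if does (u Fin.≟ v) then 1ℂ else 0ℂ

𝐞 : Fin n → Vector ℂ n
𝐞 u = δ u

Id : Matrix ℂ n
Id = δ

_·ᴹ_ : Matrix ℂ n → Matrix ℂ n → Matrix ℂ n
(X ·ᴹ Y) u v = sumℂ λ w → X u w *ᶜ Y w v

_^ᴹ_ : Matrix ℂ n → ℕ → Matrix ℂ n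
X ^ᴹ zero  = Id
X ^ᴹ suc k = X ·ᴹ (X ^ᴹ k)

_·ⱽ_ : Matrix ℂ n → Vector ℂ n → Vector ℂ n
(X ·ⱽ x) u = sumℂ λ v → X u v *ᶜ x v

conjᴹ : Matrix ℂ n → Matrix ℂ n
conjᴹ X u v = conj (X u v)

_∘ⱽ_ _-ⱽ_ : Vector ℂ n → Vector ℂ n → Vector ℂ n
(x ∘ⱽ y) u = x u *ᶜ y u
(x -ⱽ y) u = x u -ᶜ y u

-- E is the sum of the series Σ_k X^k / k!.
_IsExpOf_ : Matrix ℂ n → Matrix ℂ n → Set
E IsExpOf X = ∀ u v →
  (λ m → sumℂ {m} λ k →
     ofℝ (recip (toℕ k !) {{toℕ k ℕ.!≢0}}) *ᶜ (X ^ᴹ toℕ k) u v) ⟶ᶜ E u v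

-- r is the Euclidean norm of x, the nonnegative square root of Σ_u |x_u|².
_IsNormOf_ : ℝ → Vector ℂ n → Set
r IsNormOf x = (0ℝ ≤ r) × (r * r ≈ sumℝ λ u → ∣ x u ∣²)

-- Finite simple graphs, presented by enumerations of their vertices and
-- of their edges; the order of the two ends of an edge is immaterial.

record Graph : Set where
  field
    #V #E     : ℕ
    end₁ end₂ : Fin #E → Fin #V

  Joins : Fin #E → Fin #V → Fin #V → Set
  Joins e u v = (end₁ e ≡ u × end₂ e ≡ v) ⊎ (end₁ e ≡ v × end₂ e ≡ u)

  field
    loopless : ∀ e u → ¬ Joins e u u
    simple   : ∀ e f u v → Joins e u v → Joins f u v → e ≡ f

  joins? : ∀ e u v → Dec (Joins e u v)
  joins? e u v = (end₁ e Fin.≟ u ×-dec end₂ e Fin.≟ v)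
           ⊎-dec (end₁ e Fin.≟ v ×-dec end₂ e Fin.≟ u)

  Adj : Fin #V → Fin #V → Set
  Adj u v = ∃[ e ] Joins e u v

  Connected : Set
  Connected = ∀ u v → Star Adj u v

  -- A cycle c₀, …, c₂₊ₖ on 3 + k distinct vertices.
  record Cycle : Set where
    field
      {k}       : ℕ
      c         : Fin (3 ℕ.+ k) → Fin #V
      injective : Injective _≡_ _≡_ c
      step      : ∀ i → Adj (c (inject₁ i)) (c (suc i))
      close     : Adj (c (fromℕ (2 ℕ.+ k))) (c zero)

  record IsTree : Set where
    field
      nonEmpty  : Fin #V
      connected : Connected
      acyclic   : ¬ Cycle

module Subdivision (X : Graph) where
  open Graph X

  old : Fin #V → Fin (#V ℕ.+ #E)
  old u = u ↑ˡ #E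

  new : Fin #E → Fin (#V ℕ.+ #E)
  new e = #V ↑ʳ e

  -- inj₁ e is the edge from end₁ e to the new vertex on e, inj₂ e the one
  -- from that vertex to end₂ e.
  half₁ half₂ : Fin #E ⊎ Fin #E → Fin (#V ℕ.+ #E)
  half₁ = [ (λ e → old (end₁ e)) , new ]′
  half₂ = [ new , (λ e → old (end₂ e)) ]′

  private
    old≢new : ∀ {u e} → old u ≢ new e
    old≢new {u} {e} eq with () ←
      trans (sym (Fin.splitAt-↑ˡ #V u #E))
            (trans (cong (splitAt #V) eq) (Fin.splitAt-↑ʳ #V #E e))

    old-injective : ∀ {u v} → old u ≡ old v → u ≡ v
    old-injective {u} {v} = Fin.↑ˡ-injective #E u v

    new-injective : ∀ {e f} → new e ≡ new f → e ≡ f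
    new-injective {e} {f} = Fin.↑ʳ-injective #V e f

    end₁≢end₂ : ∀ {e f} → new e ≡ new f → old (end₁ e) ≢ old (end₂ f)
    end₁≢end₂ {e} e≡f eq with refl ← new-injective e≡f =
      loopless e (end₁ e) (inj₁ (refl , sym (old-injective eq)))

    half-loopless : ∀ h → half₁ h ≢ half₂ h
    half-loopless (inj₁ e) eq = old≢new eq
    half-loopless (inj₂ e) eq = old≢new (sym eq)

    half-simple : ∀ g h → (half₁ g ≡ half₁ h × half₂ g ≡ half₂ h)
                        ⊎ (half₁ g ≡ half₂ h × half₂ g ≡ half₁ h) → g ≡ h
    half-simple (inj₁ e) (inj₁ f) (inj₁ (_ , q)) = cong inj₁ (new-injective q)
    half-simple (inj₁ e) (inj₁ f) (inj₂ (p , _)) = contradiction p old≢new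
    half-simple (inj₁ e) (inj₂ f) (inj₁ (p , _)) = contradiction p old≢new
    half-simple (inj₁ e) (inj₂ f) (inj₂ (p , q)) = contradiction p (end₁≢end₂ q)
    half-simple (inj₂ e) (inj₁ f) (inj₁ (p , _)) = contradiction (sym p) old≢new
    half-simple (inj₂ e) (inj₁ f) (inj₂ (p , q)) = contradiction (sym q) (end₁≢end₂ (sym p))
    half-simple (inj₂ e) (inj₂ f) (inj₁ (p , _)) = cong inj₂ (new-injective p)
    half-simple (inj₂ e) (inj₂ f) (inj₂ (_ , q)) = contradiction q old≢new

    splitAt-injective : ∀ k l → splitAt #E k ≡ splitAt #E {#E} l → k ≡ l
    splitAt-injective k l eq =
      trans (sym (Fin.join-splitAt #E #E k))
            (trans (cong (join #E #E) eq) (Fin.join-splitAt #E #E l))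

    same-ends : ∀ {a b c d u v : Fin (#V ℕ.+ #E)} →
      (a ≡ u × b ≡ v) ⊎ (a ≡ v × b ≡ u) → (c ≡ u × d ≡ v) ⊎ (c ≡ v × d ≡ u) →
      (a ≡ c × b ≡ d) ⊎ (a ≡ d × b ≡ c)
    same-ends (inj₁ (refl , refl)) (inj₁ (refl , refl)) = inj₁ (refl , refl)
    same-ends (inj₁ (refl , refl)) (inj₂ (refl , refl)) = inj₂ (refl , refl)
    same-ends (inj₂ (refl , refl)) (inj₁ (refl , refl)) = inj₂ (refl , refl)
    same-ends (inj₂ (refl , refl)) (inj₂ (refl , refl)) = inj₁ (refl , refl)

  subdivision : Graph
  subdivision = record
    { #V       = #V ℕ.+ #E
    ; #E       = #E ℕ.+ #E
    ; end₁     = λ k → half₁ (splitAt #E k)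
    ; end₂     = λ k → half₂ (splitAt #E k)
    ; loopless = λ { k u (inj₁ (p , q)) → half-loopless (splitAt #E k) (trans p (sym q))
                   ; k u (inj₂ (p , q)) → half-loopless (splitAt #E k) (trans p (sym q)) }
    ; simple   = λ k l u v jk jl → splitAt-injective k l
                   (half-simple (splitAt #E k) (splitAt #E l) (same-ends jk jl))
    }

open Subdivision public using () renaming (subdivision to S)
open Graph public using (#V; #E; IsTree)

record PositiveWeights (X : Graph) : Set where
  field
    weight   : Fin (#E X) → ℝ
    positive : ∀ e → 0ℝ < weight e

-- The (u, v) entry is the weight of the edge joining u and v if there is
-- one, and 0 otherwise: as X is simple, at most one summand is nonzero.
adjacencyMatrix : (X : Graph) → PositiveWeights X → Matrix ℝ (#V X)
adjacencyMatrix X w u v =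
  sumℝ λ e → if does (Graph.joins? X e u v) then PositiveWeights.weight w e else 0ℝ

i_•_ : ℝ → Matrix ℝ n → Matrix ℂ n
(i t • A) u v = (iℂ *ᶜ ofℝ t) *ᶜ ofℝ (A u v)

-- The length of the uniform vector is nonzero because it has an index u.
uniform : Vector ℂ n
uniform {n} u = ofℝ (recip n {{Fin.nonZeroIndex u}})

-- U is e^{iτA} and r the norm of the vector at u; both exist for all τ and
-- u, and are unique up to _≈_.
ε-UniformMixing : Matrix ℝ n → Set
ε-UniformMixing {n} A = ∀ (ε : ℝ) → 0ℝ < ε →
  ∃[ τ ] Σ (Matrix ℂ n) λ U → U IsExpOf (i τ • A) ×
    (∀ u → ∃[ r ] (r IsNormOf (((U ·ⱽ 𝐞 u) ∘ⱽ (conjᴹ U ·ⱽ 𝐞 u)) -ⱽ uniform) × r < ε))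

{-# OPTIONS --safe #-}

-- S(T) is bipartite (old against new vertices) and has |V| + |E| = 2|E| + 1
-- vertices, an odd number N ≥ 3.  After conjugation with a diagonal matrix of
-- entries 1 and i, iτA becomes a real skew-symmetric matrix K, so U(τ) becomes
-- the real orthogonal matrix e^K.  If all |U(τ)_{wu}|² were nearly 1/N, then
-- √N e^K would be close to a ±1 matrix with orthogonal columns; but the inner
-- product of two ±1 vectors of odd length is odd, hence not close to 0.
--
-- Real numbers are Cauchy sequences with pointwise arithmetic, so for a fixed
-- truncation m of the exponential series everything happens at one index j of
-- these sequences, i.e. for rational matrices.

module Submission where

open import Defs renaming (_+_ to _+ℝ_; _*_ to _*ℝ_; -_ to -ℝ_; _-_ to _-ℝ_; _<_ to _<ℝ_; _≤_ to _≤ℝ_)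
open import Algebra.Bundles using (CommutativeRing)
open import Data.Bool.Base using (Bool; true; false; if_then_else_)
open import Data.Fin.Base using (Fin; zero; suc; toℕ; fromℕ; fromℕ<; inject₁; punchIn; punchOut; splitAt)
import Data.Fin.Properties as Fin
import Data.Integer.Base as ℤ
import Data.Integer.Properties as ℤ
open import Data.Nat.Base as ℕ using (ℕ; zero; suc; _!)
import Data.Nat.Properties as ℕ
open import Data.Product using (∃-syntax; _×_; _,_; proj₁; proj₂)
open import Data.Rational.Base as ℚ using (ℚ; 0ℚ; 1ℚ; _+_; _*_; -_; _-_; _≤_; _<_; ∣_∣)
import Data.Rational.Properties as ℚ
import Data.Rational.Unnormalised.Base as ℚᵘ
import Data.Rational.Unnormalised.Properties as ℚᵘ
open import Data.Sum.Base as Sum using (_⊎_; inj₁; inj₂; [_,_]′)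
open import Data.Vec.Functional using (Vector)
open import Function.Base using (_∘_; id)
open import Function.Bundles using (mk⇔)
open import Function.Definitions using (Injective)
open import Relation.Binary.Construct.Closure.ReflexiveTransitive as Star using (Star; _◅_; _◅◅_)
open import Relation.Binary.PropositionalEquality
open import Relation.Nullary using (¬_; does; yes; no; contradiction)
open import Relation.Nullary.Decidable using (does-⇔; dec-false; dec⇒maybe)
open import Tactic.RingSolver using (solve-∀)
open import Tactic.RingSolver.Core.AlmostCommutativeRing using (AlmostCommutativeRing; fromCommutativeRing)

open import Algebra.Properties.Semiring.Sum (CommutativeRing.semiring ℚ.+-*-commutativeRing)
  using (sum; sum-cong-≗; ∑-comm; ∑-distrib-+; *-distribˡ-sum; *-distribʳ-sum; sum-replicate-zero)

-- Counting the edges of a tree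

-- Rounding the entries of `√N e^K` would need `√N`, which is irrational in general. For two columns
-- x and y the products `N x_w y_w` serve instead: their squares `(N x_w²)(N y_w²)` are close to 1,
-- and their sum is N times the inner product. Two columns suffice, and both are taken at old
-- vertices, whose characteristic vectors are fixed by the diagonal matrix. The obstacle is the
-- order of choices. Mixing yields τ; only then is there a bound M on the entries of K, a truncation
-- m and, depending on m, an index j. A truncated exponential is not orthogonal, so its defect has
-- to be bounded uniformly over all rational skew-symmetric K with entries at most M, before j is
-- known. In the product of two truncated series the terms of total degree below m cancel exactly,
-- by `(1 - 1)^l = 0` on each antidiagonal, and the rest is small because factorials beat geometric
-- growth. As the goal is a contradiction, one pair m, j is enough.

module Paths {n} (R : Fin n → Fin n → Set) where

  -- Simple paths. `vertex` is defined simultaneously because `cons` demands that the new vertex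
  -- avoid all those of the tail; the resulting injectivity is what `Cycle` asks for.
  mutual
    data Path : ℕ → Fin n → Fin n → Set where
      nil  : ∀ {u} → Path 0 u u
      cons : ∀ {k u v w} → R u v → (p : Path k v w) → (∀ i → vertex p i ≢ u) → Path (suc k) u w

    vertex : ∀ {k u v} → Path k u v → Fin (suc k) → Fin n
    vertex {u = u} nil          _       = u
    vertex {u = u} (cons _ _ _) zero    = u
    vertex         (cons _ p _) (suc i) = vertex p i

  vertex-first : ∀ {k u v} (p : Path k u v) → vertex p zero ≡ u
  vertex-first nil          = refl
  vertex-first (cons _ _ _) = refl

  vertex-last : ∀ {k u v} (p : Path k u v) → vertex p (fromℕ k) ≡ v
  vertex-last nil          = refl
  vertex-last (cons _ p _) = vertex-last p

  vertex-step : ∀ {k u v} (p : Path k u v) i → R (vertex p (inject₁ i)) (vertex p (suc i))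
  vertex-step (cons r p _) zero    = subst (R _) (sym (vertex-first p)) r
  vertex-step (cons _ p _) (suc i) = vertex-step p i

  vertex-injective : ∀ {k u v} (p : Path k u v) → Injective _≡_ _≡_ (vertex p)
  vertex-injective nil {zero} {zero} _ = refl
  vertex-injective (cons _ _ _) {zero}  {zero}  _  = refl
  vertex-injective (cons _ _ ∉) {zero}  {suc j} eq = contradiction (sym eq) (∉ j)
  vertex-injective (cons _ _ ∉) {suc i} {zero}  eq = contradiction eq (∉ i)
  vertex-injective (cons _ p _) {suc i} {suc j} eq = cong suc (vertex-injective p eq)

  suffix : ∀ {k u v} (p : Path k u v) i → ∃[ l ] Path l (vertex p i) v
  suffix nil            _       = 0 , nil
  suffix p@(cons _ _ _) zero    = _ , p
  suffix (cons _ p _)   (suc i) = suffix p i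

  -- Loop erasure: if the new starting vertex already lies on the path, only the part from there on
  -- is kept.
  fromStar : ∀ {u v} → Star R u v → ∃[ k ] Path k u v
  fromStar Star.ε = 0 , nil
  fromStar {u} (r ◅ rs) with k , p ← fromStar rs with Fin.any? (λ i → vertex p i Fin.≟ u)
  ... | yes (i , refl) = suffix p i
  ... | no  ∉          = suc k , cons r p (λ i eq → ∉ (i , eq))

module EdgeCount (T : Graph) where
  open Graph T hiding (#V; #E; IsTree)

  AdjBelow : ℕ → Fin (#V T) → Fin (#V T) → Set
  AdjBelow k u v = ∃[ e ] (toℕ e ℕ.< k × Joins e u v)

  weaken : ∀ {k u v} → Star (AdjBelow k) u v → Star (AdjBelow (suc k)) u v
  weaken = Star.map λ (e , e<k , j) → e , ℕ.m<n⇒m<1+n e<k , j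

  -- The walk shortens to a simple path. Length 0 makes `e` a loop, length 1 gives an earlier edge
  -- parallel to `e`, and a longer path closes up along `e` to a cycle.
  acyclic⇒¬reach : ¬ Cycle → ∀ e → ¬ Star (AdjBelow (toℕ e)) (end₂ e) (end₁ e)
  acyclic⇒¬reach acyclic e walk with Paths.fromStar _ walk
  ... | 0 , p = loopless e (end₂ e) (inj₁ (trans (sym (Paths.vertex-last _ p)) (Paths.vertex-first _ p) , refl))
  ... | 1 , Paths.cons (f , f<e , j) Paths.nil _ =
    ℕ.<-irrefl (cong toℕ (simple f e (end₂ e) (end₁ e) j (inj₂ (refl , refl)))) f<e
  ... | suc (suc k) , p = acyclic record
    { c         = Paths.vertex _ p
    ; injective = Paths.vertex-injective _ p
    ; step      = λ i → let f , _ , j = Paths.vertex-step _ p i in f , j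
    ; close     = e , inj₁ (sym (Paths.vertex-last _ p) , sym (Paths.vertex-first _ p))
    }

  -- The components of the graph formed by the edges numbered below `k`: `reachable` and `respects`
  -- say that the classes of `label` are neither too large nor too small. `count` expresses that
  -- this graph is a forest, each edge having merged two components.
  record Components (k : ℕ) : Set where
    field
      {c}       : ℕ
      count     : c ℕ.+ k ≡ #V T
      label     : Fin (#V T) → Fin c
      onto      : ∀ x → ∃[ u ] label u ≡ x
      reachable : ∀ u v → label u ≡ label v → Star (AdjBelow k) u v
      respects  : ∀ e → toℕ e ℕ.< k → label (end₁ e) ≡ label (end₂ e)

  none : Components 0
  none = record
    { count = ℕ.+-identityʳ _ ; label = id ; onto = λ x → x , refl
    ; reachable = λ { u .u refl → Star.ε } ; respects = λ _ () }

  -- Identifies `y` with `x` by deleting `y` from the range, so that the labels again have no gaps.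
  merge : ∀ {c} (x y : Fin (suc c)) → y ≢ x → Fin (suc c) → Fin c
  merge x y y≢x z with y Fin.≟ z
  ... | yes _  = punchOut y≢x
  ... | no y≢z = punchOut y≢z

  merge-≡ : ∀ {c} (x y : Fin (suc c)) y≢x → merge x y y≢x x ≡ merge x y y≢x y
  merge-≡ x y y≢x with y Fin.≟ x | y Fin.≟ y
  ... | yes y≡x | _       = contradiction y≡x y≢x
  ... | no _    | no y≢y  = contradiction refl y≢y
  ... | no _    | yes _   = Fin.punchOut-cong y refl

  merge-punchIn : ∀ {c} (x y : Fin (suc c)) y≢x z → merge x y y≢x (punchIn y z) ≡ z
  merge-punchIn x y y≢x z with y Fin.≟ punchIn y z
  ... | yes eq = contradiction (sym eq) (Fin.punchInᵢ≢i y z)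
  ... | no  _  = trans (Fin.punchOut-cong y refl) (Fin.punchOut-punchIn y)

  merge-injective : ∀ {c} (x y : Fin (suc c)) y≢x z t → merge x y y≢x z ≡ merge x y y≢x t →
                    z ≡ t ⊎ ((z ≡ x × t ≡ y) ⊎ (z ≡ y × t ≡ x))
  merge-injective x y y≢x z t eq with y Fin.≟ z | y Fin.≟ t
  ... | yes refl | yes refl = inj₁ refl
  ... | yes y≡z  | no y≢t   = inj₂ (inj₂ (sym y≡z , sym (Fin.punchOut-injective y≢x y≢t eq)))
  ... | no y≢z   | yes y≡t  = inj₂ (inj₁ (Fin.punchOut-injective y≢z y≢x eq , sym y≡t))
  ... | no y≢z   | no y≢t   = inj₁ (Fin.punchOut-injective y≢z y≢t eq)

  addEdge : ¬ Cycle → ∀ e → Components (toℕ e) → Components (suc (toℕ e))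
  addEdge acyclic e C with Components.c C in c≡
  ... | zero with () ← subst Fin c≡ (Components.label C (end₁ e))
  ... | suc c with refl ← c≡ = record
    { count     = trans (ℕ.+-suc c (toℕ e)) count
    ; label     = label′
    ; onto      = λ z → let u , eq = onto (punchIn y z) in
                        u , trans (cong mrg eq) (merge-punchIn x y y≢x z)
    ; reachable = λ u v eq → reach u v (merge-injective x y y≢x _ _ eq)
    ; respects  = respects′
    }
    where
    open Components C hiding (c)
    x = label (end₁ e)
    y = label (end₂ e)
    -- Acyclicity enters here: equal labels would mean that earlier edges already join the ends of
    -- `e`.
    y≢x : y ≢ x
    y≢x eq = acyclic⇒¬reach acyclic e (reachable _ _ eq)
    mrg = merge x y y≢x
    label′ = mrg ∘ label
    reach : ∀ u v → label u ≡ label v ⊎ ((label u ≡ x × label v ≡ y) ⊎ (label u ≡ y × label v ≡ x)) →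
            Star (AdjBelow (suc (toℕ e))) u v
    reach u v (inj₁ eq) = weaken (reachable u v eq)
    reach u v (inj₂ (inj₁ (p , q))) = weaken (reachable u (end₁ e) p)
      ◅◅ (e , ℕ.n<1+n _ , inj₁ (refl , refl)) ◅ weaken (reachable (end₂ e) v (sym q))
    reach u v (inj₂ (inj₂ (p , q))) = weaken (reachable u (end₂ e) p)
      ◅◅ (e , ℕ.n<1+n _ , inj₂ (refl , refl)) ◅ weaken (reachable (end₁ e) v (sym q))
    respects′ : ∀ f → toℕ f ℕ.< suc (toℕ e) → label′ (end₁ f) ≡ label′ (end₂ f)
    respects′ f f<1+e with ℕ.m<1+n⇒m<n∨m≡n f<1+e
    ... | inj₁ f<e = cong mrg (respects f f<e)
    ... | inj₂ f≡e with refl ← Fin.toℕ-injective f≡e = merge-≡ x y y≢x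

  components : ¬ Cycle → ∀ k → k ℕ.≤ #E T → Components k
  components _       zero    _   = none
  components acyclic (suc k) k<E = subst (Components ∘ suc) k≡
    (addEdge acyclic (fromℕ< k<E) (subst Components (sym k≡) (components acyclic k (ℕ.<⇒≤ k<E))))
    where
    k≡ : toℕ (fromℕ< k<E) ≡ k
    k≡ = Fin.toℕ-fromℕ< k<E

  -- With all edges present, connectedness makes `label` constant; being onto, it has a single
  -- value, so `c` is 1.
  #V≡1+#E : IsTree T → #V T ≡ suc (#E T)
  #V≡1+#E tree = trans (sym count) (cong (ℕ._+ #E T) (one c (label nonEmpty) allEqual))
    where
    open Graph.IsTree tree
    open Components (components acyclic (#E T) ℕ.≤-refl)
    constant : ∀ {u v} → Star Adj u v → label u ≡ label v
    constant Star.ε = refl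
    constant ((e , inj₁ (refl , refl)) ◅ w) = trans (respects e (Fin.toℕ<n e)) (constant w)
    constant ((e , inj₂ (refl , refl)) ◅ w) = trans (sym (respects e (Fin.toℕ<n e))) (constant w)
    allEqual : ∀ x y → x ≡ y
    allEqual x y with u , refl ← onto x | v , refl ← onto y = constant (connected u v)
    one : ∀ c → Fin c → (∀ (x y : Fin c) → x ≡ y) → c ≡ 1
    one 1             _ _  = refl
    one (suc (suc _)) _ eq with () ← eq zero (suc zero)

ℚ-ring : AlmostCommutativeRing _ _
ℚ-ring = fromCommutativeRing ℚ.+-*-commutativeRing (λ q → dec⇒maybe (0ℚ ℚ.≟ q))

-- Order and absolute value on ℚ

*-monoˡ-≤ : ∀ {a b c} → 0ℚ ≤ a → b ≤ c → a * b ≤ a * c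
*-monoˡ-≤ {a} 0≤a = ℚ.*-monoˡ-≤-nonNeg a {{ℚ.nonNegative 0≤a}}

*-mono-≤ : ∀ {a b c d} → 0ℚ ≤ b → 0ℚ ≤ c → a ≤ b → c ≤ d → a * c ≤ b * d
*-mono-≤ {c = c} 0≤b 0≤c a≤b c≤d =
  ℚ.≤-trans (ℚ.*-monoʳ-≤-nonNeg c {{ℚ.nonNegative 0≤c}} a≤b) (*-monoˡ-≤ 0≤b c≤d)

*-nonNeg : ∀ {a b} → 0ℚ ≤ a → 0ℚ ≤ b → 0ℚ ≤ a * b
*-nonNeg {a} {b} 0≤a 0≤b = subst (_≤ a * b) (ℚ.*-zeroʳ a) (*-monoˡ-≤ 0≤a 0≤b)

+-nonNeg : ∀ {a b} → 0ℚ ≤ a → 0ℚ ≤ b → 0ℚ ≤ a + b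
+-nonNeg = ℚ.+-mono-≤

*-cancelˡ-≤ : ∀ {a b c} → 0ℚ < a → a * b ≤ a * c → b ≤ c
*-cancelˡ-≤ {a} 0<a = ℚ.*-cancelˡ-≤-pos a {{ℚ.positive 0<a}}

p≤∣p∣ : ∀ p → p ≤ ∣ p ∣
p≤∣p∣ p with ℚ.≤-total 0ℚ p
... | inj₁ 0≤p = ℚ.≤-reflexive (sym (ℚ.0≤p⇒∣p∣≡p 0≤p))
... | inj₂ p≤0 = ℚ.≤-trans p≤0 (ℚ.0≤∣p∣ p)

∣p∣≤q : ∀ {p q} → p ≤ q → - p ≤ q → ∣ p ∣ ≤ q
∣p∣≤q {p} p≤q -p≤q with ℚ.∣p∣≡p∨∣p∣≡-p p
... | inj₁ eq = subst (_≤ _) (sym eq) p≤q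
... | inj₂ eq = subst (_≤ _) (sym eq) -p≤q

∣p+q∣≤ : ∀ {p q a b} → ∣ p ∣ ≤ a → ∣ q ∣ ≤ b → ∣ p + q ∣ ≤ a + b
∣p+q∣≤ {p} {q} p≤a q≤b = ℚ.≤-trans (ℚ.∣p+q∣≤∣p∣+∣q∣ p q) (ℚ.+-mono-≤ p≤a q≤b)

∣p*q∣≤ : ∀ {p q a b} → ∣ p ∣ ≤ a → ∣ q ∣ ≤ b → ∣ p * q ∣ ≤ a * b
∣p*q∣≤ {p} {q} p≤a q≤b = subst (_≤ _) (sym (ℚ.∣p*q∣≡∣p∣*∣q∣ p q))
  (*-mono-≤ (ℚ.≤-trans (ℚ.0≤∣p∣ p) p≤a) (ℚ.0≤∣p∣ q) p≤a q≤b)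

-- Natural numbers as rationals

ι : ℕ → ℚ
ι zero    = 0ℚ
ι (suc n) = 1ℚ + ι n

0≤1 : 0ℚ ≤ 1ℚ
0≤1 = ℚ.<⇒≤ (ℚ.positive⁻¹ 1ℚ)

0≤ι : ∀ n → 0ℚ ≤ ι n
0≤ι zero    = ℚ.≤-refl
0≤ι (suc n) = +-nonNeg 0≤1 (0≤ι n)

ι-+ : ∀ m n → ι (m ℕ.+ n) ≡ ι m + ι n
ι-+ zero    n = sym (ℚ.+-identityˡ (ι n))
ι-+ (suc m) n = trans (cong (1ℚ +_) (ι-+ m n)) (sym (ℚ.+-assoc 1ℚ (ι m) (ι n)))

ι-* : ∀ m n → ι (m ℕ.* n) ≡ ι m * ι n
ι-* zero    n = sym (ℚ.*-zeroˡ (ι n))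
ι-* (suc m) n = trans (ι-+ n (m ℕ.* n)) (trans (cong (ι n +_) (ι-* m n)) (lemma (ι m) (ι n)))
  where
  lemma : ∀ a b → b + a * b ≡ (1ℚ + a) * b
  lemma = solve-∀ ℚ-ring

ι-mono-≤ : ∀ {m n} → m ℕ.≤ n → ι m ≤ ι n
ι-mono-≤ {n = n} ℕ.z≤n = 0≤ι n
ι-mono-≤ (ℕ.s≤s m≤n)   = ℚ.+-monoʳ-≤ 1ℚ (ι-mono-≤ m≤n)

0<ι : ∀ n .{{_ : ℕ.NonZero n}} → 0ℚ < ι n
0<ι (suc n) = ℚ.<-≤-trans (ℚ.positive⁻¹ 1ℚ) (ι-mono-≤ {1} {suc n} (ℕ.s≤s ℕ.z≤n))

inv : (n : ℕ) .{{_ : ℕ.NonZero n}} → ℚ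
inv n = ℤ.+ 1 ℚ./ n

ι-toℚᵘ : ∀ n → ℚ.toℚᵘ (ι n) ℚᵘ.≃ (ℤ.+ n ℚᵘ./ 1)
ι-toℚᵘ zero    = ℚᵘ.≃-refl
ι-toℚᵘ (suc n) = ℚᵘ.≃-trans (ℚ.toℚᵘ-homo-+ 1ℚ (ι n))
  (ℚᵘ.≃-trans (ℚᵘ.+-congʳ ℚᵘ.1ℚᵘ (ι-toℚᵘ n)) (ℚᵘ.*≡* (cong (λ k → (ℤ.+ 1 ℤ.+ k) ℤ.* ℤ.+ 1) (ℤ.*-identityʳ (ℤ.+ n)))))

-- Proved over the unnormalised rationals, where equality is cross multiplication and the gcd hidden
-- in `inv n` disappears.
ι-inv : ∀ n .{{_ : ℕ.NonZero n}} → ι n * inv n ≡ 1ℚ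
ι-inv n@(suc k) = ℚ.toℚᵘ-injective (ℚᵘ.≃-trans (ℚ.toℚᵘ-homo-* (ι n) (inv n))
  (ℚᵘ.≃-trans (ℚᵘ.*-cong (ι-toℚᵘ n) (ℚ.toℚᵘ-fromℚᵘ (ℤ.+ 1 ℚᵘ./ n)))
    (ℚᵘ.*≡* (cong ℤ.+_ (lemma k)))))
  where
  lemma : ∀ k → suc k ℕ.* 1 ℕ.* 1 ≡ 1 ℕ.* (1 ℕ.* suc k)
  lemma k rewrite ℕ.*-identityʳ (suc k ℕ.* 1) | ℕ.*-identityʳ k | ℕ.+-identityʳ k | ℕ.+-identityʳ k = refl

0<inv : ∀ n .{{_ : ℕ.NonZero n}} → 0ℚ < inv n
0<inv n = ℚ.positive⁻¹ (inv n) {{ℚ.normalize-pos 1 n}}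

-- The denominator is at least 1, so the absolute value of the numerator is already a bound.
archimedean : ∀ (q : ℚ) → ∃[ n ] q ≤ ι n
archimedean q@(ℚ.mkℚ p d-1 _) = ℤ.∣ p ∣ , ℚ.toℚᵘ-cancel-≤
  (ℚᵘ.≤-trans (ℚᵘ.*≤* (lemma p)) (ℚᵘ.≤-reflexive (ℚᵘ.≃-sym (ι-toℚᵘ ℤ.∣ p ∣))))
  where
  lemma : ∀ p → p ℤ.* ℤ.+ 1 ℤ.≤ ℤ.+ ℤ.∣ p ∣ ℤ.* ℤ.+ suc d-1
  lemma (ℤ.+ n) = subst₂ ℤ._≤_ (sym (ℤ.*-identityʳ (ℤ.+ n))) (ℤ.pos-* n (suc d-1)) (ℤ.+≤+ (ℕ.m≤m*n n (suc d-1)))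
  lemma ℤ.-[1+ n ] = subst₂ ℤ._≤_ (sym (ℤ.*-identityʳ ℤ.-[1+ n ])) (ℤ.pos-* (suc n) (suc d-1)) ℤ.-≤+

archimedean-* : ∀ (q : ℚ) {ε} → 0ℚ < ε → ∃[ n ] q ≤ ι n * ε
archimedean-* q {ε} 0<ε = let n , q/ε≤n = archimedean (q * ℚ.1/ ε) in n , (begin
  q                  ≡⟨ sym (ℚ.*-identityʳ q) ⟩
  q * 1ℚ             ≡⟨ cong (q *_) (sym (ℚ.*-inverseˡ ε)) ⟩
  q * (ℚ.1/ ε * ε)   ≡⟨ sym (ℚ.*-assoc q (ℚ.1/ ε) ε) ⟩
  q * ℚ.1/ ε * ε     ≤⟨ ℚ.*-monoʳ-≤-nonNeg ε {{ℚ.nonNegative (ℚ.<⇒≤ 0<ε)}} q/ε≤n ⟩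
  ι n * ε            ∎)
  where
  open ℚ.≤-Reasoning
  instance
    ε≢0 : ℚ.NonZero ε
    ε≢0 = ℚ.pos⇒nonZero ε {{ℚ.positive 0<ε}}

-- Finite sums

-- Indexed by `Fin m` like the partial sums in `_IsExpOf_`, so that the two match without
-- reindexing.
∑ : ℕ → (ℕ → ℚ) → ℚ
∑ m f = sum {m} (λ i → f (toℕ i))

∑-last : ∀ m f → ∑ (suc m) f ≡ ∑ m f + f m
∑-last zero    f = trans (ℚ.+-identityʳ (f 0)) (sym (ℚ.+-identityˡ (f 0)))
∑-last (suc m) f = trans (cong (f 0 +_) (∑-last m (f ∘ suc))) (sym (ℚ.+-assoc (f 0) _ _))

∣sum∣≤ : ∀ {n C} (f : Vector ℚ n) → (∀ i → ∣ f i ∣ ≤ C) → ∣ sum f ∣ ≤ ι n * C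
∣sum∣≤ {zero}  {C} f ∣f∣≤C = ℚ.≤-reflexive (sym (ℚ.*-zeroˡ C))
∣sum∣≤ {suc n} {C} f ∣f∣≤C = subst (_ ≤_) (lemma C (ι n))
  (∣p+q∣≤ {f zero} (∣f∣≤C zero) (∣sum∣≤ (f ∘ suc) (∣f∣≤C ∘ suc)))
  where
  lemma : ∀ c m → c + m * c ≡ (1ℚ + m) * c
  lemma = solve-∀ ℚ-ring

∑-tail : ∀ {a m C} f → 0ℚ ≤ C → a ℕ.≤ m → (∀ k → a ℕ.≤ k → ∣ f k ∣ ≤ C) → ∣ ∑ m f - ∑ a f ∣ ≤ ι m * C
∑-tail {m = m} f 0≤C ℕ.z≤n ∣f∣≤C = subst (λ x → ∣ x ∣ ≤ _) (sym (ℚ.+-identityʳ (∑ m f)))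
  (∣sum∣≤ {m} (f ∘ toℕ) (λ i → ∣f∣≤C (toℕ i) ℕ.z≤n))
∑-tail {suc a} {suc m} {C} f 0≤C (ℕ.s≤s a≤m) ∣f∣≤C =
  subst (λ x → ∣ x ∣ ≤ _) (lemma (f 0) (∑ m (f ∘ suc)) (∑ a (f ∘ suc)))
    (ℚ.≤-trans (∑-tail (f ∘ suc) 0≤C a≤m (λ k a≤k → ∣f∣≤C (suc k) (ℕ.s≤s a≤k)))
      (ℚ.*-monoʳ-≤-nonNeg C {{ℚ.nonNegative 0≤C}} (ι-mono-≤ (ℕ.n≤1+n m))))
  where
  lemma : ∀ x y z → y - z ≡ (x + y) - (x + z)
  lemma = solve-∀ ℚ-ring

-- The sum of `f j k` over `j + k = l`; `triangle f m` below is the sum over `j + k < m`. Both peel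
-- off the row `j = 0`.
diagonal : (ℕ → ℕ → ℚ) → ℕ → ℚ
diagonal f zero    = f 0 0
diagonal f (suc l) = f 0 (suc l) + diagonal (f ∘ suc) l

triangle : (ℕ → ℕ → ℚ) → ℕ → ℚ
triangle f zero    = 0ℚ
triangle f (suc m) = ∑ (suc m) (f 0) + triangle (f ∘ suc) m

triangle-suc : ∀ f m → triangle f (suc m) ≡ triangle f m + diagonal f m
triangle-suc f zero    = lemma (f 0 0)
  where
  lemma : ∀ a → (a + 0ℚ) + 0ℚ ≡ 0ℚ + a
  lemma = solve-∀ ℚ-ring
triangle-suc f (suc m) = trans
  (cong₂ _+_ (∑-last (suc m) (f 0)) (triangle-suc (f ∘ suc) m))
  (lemma (∑ (suc m) (f 0)) (f 0 (suc m)) (triangle (f ∘ suc) m) (diagonal (f ∘ suc) m))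
  where
  lemma : ∀ a b c d → (a + b) + (c + d) ≡ (a + c) + (b + d)
  lemma = solve-∀ ℚ-ring

triangle≡0 : ∀ f → (∀ l → diagonal f l ≡ 0ℚ) → ∀ m → triangle f m ≡ 0ℚ
triangle≡0 f d≡0 zero    = refl
triangle≡0 f d≡0 (suc m) = trans (triangle-suc f m) (cong₂ _+_ (triangle≡0 f d≡0 m) (d≡0 m))

-- Each of the `a` rows has at most `m` entries outside the triangle. Separate sizes for rows and
-- columns keep the induction going: removing a row shrinks the triangle but does not shorten the
-- remaining rows.
square-triangle : ∀ {a m C} f → 0ℚ ≤ C → a ℕ.≤ m → (∀ j k → a ℕ.≤ j ℕ.+ k → ∣ f j k ∣ ≤ C) →
                  ∣ ∑ a (λ j → ∑ m (f j)) - triangle f a ∣ ≤ ι a * (ι m * C)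
square-triangle {zero}  {m} {C} f 0≤C a≤m ∣f∣≤C = ℚ.≤-reflexive (sym (ℚ.*-zeroˡ (ι m * C)))
square-triangle {suc a} {m} {C} f 0≤C a<m ∣f∣≤C = subst₂ _≤_
  (cong ∣_∣ (regroup (∑ m (f 0)) (∑ (suc a) (f 0)) (∑ a (λ j → ∑ m (f (suc j)))) (triangle (f ∘ suc) a)))
  (lemma (ι m * C) (ι a))
  (∣p+q∣≤ {∑ m (f 0) - ∑ (suc a) (f 0)}
    (∑-tail (f 0) 0≤C a<m (∣f∣≤C 0))
    (square-triangle (f ∘ suc) 0≤C (ℕ.<⇒≤ a<m) (λ j k a≤j+k → ∣f∣≤C (suc j) k (ℕ.s≤s a≤j+k))))
  where
  regroup : ∀ x y z t → (x - y) + (z - t) ≡ (x + z) - (y + t)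
  regroup = solve-∀ ℚ-ring
  lemma : ∀ c m → c + m * c ≡ (1ℚ + m) * c
  lemma = solve-∀ ℚ-ring

-- With a = 0: l f j k = j f j k + k f j k on the l-th antidiagonal, and by
-- hypothesis the second summand cancels the first one of the next term.
diagonal-telescopes : ∀ a f →
  (∀ j k → (a + ι (suc j)) * f (suc j) k ≡ - (ι (suc k) * f j (suc k))) →
  ∀ l → (a + ι l) * diagonal f l ≡ a * f 0 l
diagonal-telescopes a f skew zero = cong (_* f 0 0) (ℚ.+-identityʳ a)
diagonal-telescopes a f skew (suc l) = begin
  (a + (1ℚ + ι l)) * (f 0 (suc l) + diagonal (f ∘ suc) l)
    ≡⟨ expand a (ι l) (f 0 (suc l)) (diagonal (f ∘ suc) l) ⟩
  (a + (1ℚ + ι l)) * f 0 (suc l) + (a + 1ℚ + ι l) * diagonal (f ∘ suc) l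
    ≡⟨ cong ((a + (1ℚ + ι l)) * f 0 (suc l) +_) (diagonal-telescopes (a + 1ℚ) (f ∘ suc) skew′ l) ⟩
  (a + (1ℚ + ι l)) * f 0 (suc l) + (a + 1ℚ) * f 1 l
    ≡⟨ cong ((a + (1ℚ + ι l)) * f 0 (suc l) +_) (skew 0 l) ⟩
  (a + (1ℚ + ι l)) * f 0 (suc l) + - ((1ℚ + ι l) * f 0 (suc l))
    ≡⟨ collect a (1ℚ + ι l) (f 0 (suc l)) ⟩
  a * f 0 (suc l) ∎
  where
  open ≡-Reasoning
  expand : ∀ a l x y → (a + (1ℚ + l)) * (x + y) ≡ (a + (1ℚ + l)) * x + (a + 1ℚ + l) * y
  expand = solve-∀ ℚ-ring
  collect : ∀ a l x → (a + l) * x + - (l * x) ≡ a * x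
  collect = solve-∀ ℚ-ring
  skew′ : ∀ j k → (a + 1ℚ + ι (suc j)) * f (suc (suc j)) k ≡ - (ι (suc k) * f (suc j) (suc k))
  skew′ j k = trans (cong (_* f (suc (suc j)) k) (ℚ.+-assoc a 1ℚ (ι (suc j)))) (skew (suc j) k)

-- The telescoped identity with `a` equal to 0 reads `l * diagonal f l = 0`. It says nothing at
-- `l = 0`, so the corner is a hypothesis.
diagonal≡0 : ∀ f → f 0 0 ≡ 0ℚ →
  (∀ j k → ι (suc j) * f (suc j) k ≡ - (ι (suc k) * f j (suc k))) →
  ∀ l → diagonal f l ≡ 0ℚ
diagonal≡0 f f00≡0 skew zero    = f00≡0
diagonal≡0 f f00≡0 skew (suc l) = begin
  diagonal f (suc l)                           ≡⟨ sym (ℚ.*-identityˡ _) ⟩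
  1ℚ * diagonal f (suc l)                      ≡⟨ cong (_* diagonal f (suc l)) (sym (trans (ℚ.*-comm (inv (suc l)) _) (ι-inv (suc l)))) ⟩
  inv (suc l) * ι (suc l) * diagonal f (suc l) ≡⟨ ℚ.*-assoc (inv (suc l)) (ι (suc l)) _ ⟩
  inv (suc l) * (ι (suc l) * diagonal f (suc l)) ≡⟨ cong (λ x → inv (suc l) * (x * diagonal f (suc l))) (sym (ℚ.+-identityˡ (ι (suc l)))) ⟩
  inv (suc l) * ((0ℚ + ι (suc l)) * diagonal f (suc l)) ≡⟨ cong (inv (suc l) *_) (diagonal-telescopes 0ℚ f skew₀ (suc l)) ⟩
  inv (suc l) * (0ℚ * f 0 (suc l))             ≡⟨ lemma (inv (suc l)) (f 0 (suc l)) ⟩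
  0ℚ                                           ∎
  where
  open ≡-Reasoning
  lemma : ∀ x y → x * (0ℚ * y) ≡ 0ℚ
  lemma = solve-∀ ℚ-ring
  skew₀ : ∀ j k → (0ℚ + ι (suc j)) * f (suc j) k ≡ - (ι (suc k) * f j (suc k))
  skew₀ j k = trans (cong (_* f (suc j) k) (ℚ.+-identityˡ (ι (suc j)))) (skew j k)

-- Exponentials of skew-symmetric rational matrices

-- Once `d ≤ k + 1`, a further factor `d` is paid for by the factor `k + 1` of the factorial; before
-- that the power is at most `d ^ d`. Hence `d ^ k / k !` is bounded in `k`.
^-≤-! : ∀ d k → d ℕ.^ k ℕ.≤ d ℕ.^ d ℕ.* k !
^-≤-! zero zero = ℕ.≤-refl
^-≤-! zero (suc k) = ℕ.z≤n
^-≤-! d@(suc _) zero = ℕ.*-mono-≤ (ℕ.^-monoʳ-≤ d {0} {d} ℕ.z≤n) ℕ.≤-refl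
^-≤-! d@(suc _) (suc k) with ℕ.≤-total d (suc k)
... | inj₁ d≤k = begin
  d ℕ.* d ℕ.^ k                     ≤⟨ ℕ.*-mono-≤ d≤k (^-≤-! d k) ⟩
  suc k ℕ.* (d ℕ.^ d ℕ.* k !)       ≡⟨ ℕ.*-assoc (suc k) (d ℕ.^ d) (k !) ⟨
  suc k ℕ.* d ℕ.^ d ℕ.* k !         ≡⟨ cong (ℕ._* k !) (ℕ.*-comm (suc k) (d ℕ.^ d)) ⟩
  d ℕ.^ d ℕ.* suc k ℕ.* k !         ≡⟨ ℕ.*-assoc (d ℕ.^ d) (suc k) (k !) ⟩
  d ℕ.^ d ℕ.* suc k !               ∎
  where open ℕ.≤-Reasoning
... | inj₂ k<d = ℕ.≤-trans (ℕ.^-monoʳ-≤ d k<d)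
  (ℕ.m≤m*n (d ℕ.^ d) (suc k !) {{suc k ℕ.!≢0}})

^-distribʳ-* : ∀ n a b → (a ℕ.* b) ℕ.^ n ≡ a ℕ.^ n ℕ.* b ℕ.^ n
^-distribʳ-* zero    a b = refl
^-distribʳ-* (suc n) a b = trans (cong (a ℕ.* b ℕ.*_) (^-distribʳ-* n a b))
  (ℕ.[m*n]*[o*p]≡[m*o]*[n*p] a b (a ℕ.^ n) (b ℕ.^ n))

n≤2^n : ∀ n → n ℕ.≤ 2 ℕ.^ n
n≤2^n zero    = ℕ.z≤n
n≤2^n (suc n) = subst (suc n ℕ.≤_) (cong (2 ℕ.^ n ℕ.+_) (sym (ℕ.+-identityʳ _)))
  (ℕ.+-mono-≤ (ℕ.m^n>0 2 n) (n≤2^n n))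

-- The origin of the base 8: it is the cube of 2, and a cube is needed, two factors for the number
-- of terms in a square of side `n` and one to get below a given bound.
n³≤8^n : ∀ n → n ℕ.* n ℕ.* n ℕ.≤ 8 ℕ.^ n
n³≤8^n n = begin
  n ℕ.* n ℕ.* n                        ≤⟨ ℕ.*-mono-≤ (ℕ.*-mono-≤ (n≤2^n n) (n≤2^n n)) (n≤2^n n) ⟩
  2 ℕ.^ n ℕ.* 2 ℕ.^ n ℕ.* 2 ℕ.^ n      ≡⟨ cong (ℕ._* 2 ℕ.^ n) (^-distribʳ-* n 2 2) ⟨
  4 ℕ.^ n ℕ.* 2 ℕ.^ n                  ≡⟨ ^-distribʳ-* n 4 2 ⟨
  8 ℕ.^ n                              ∎
  where
  open ℕ.≤-Reasoning

1/_! : ℕ → ℚ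
1/ k ! = inv (k !) {{k ℕ.!≢0}}

0≤1/! : ∀ k → 0ℚ ≤ 1/ k !
0≤1/! k = ℚ.<⇒≤ (0<inv (k !) {{k ℕ.!≢0}})

ι-1/! : ∀ k → ι (k !) * 1/ k ! ≡ 1ℚ
ι-1/! k = ι-inv (k !) {{k ℕ.!≢0}}

1/!-suc : ∀ k → ι (suc k) * 1/ suc k ! ≡ 1/ k !
1/!-suc k = begin
  ι (suc k) * 1/ suc k !                          ≡⟨ ℚ.*-identityʳ _ ⟨
  ι (suc k) * 1/ suc k ! * 1ℚ                     ≡⟨ cong (ι (suc k) * 1/ suc k ! *_) (ι-1/! k) ⟨
  ι (suc k) * 1/ suc k ! * (ι (k !) * 1/ k !)     ≡⟨ lemma (ι (suc k)) (1/ suc k !) (ι (k !)) (1/ k !) ⟩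
  ι (suc k) * ι (k !) * 1/ suc k ! * 1/ k !       ≡⟨ cong (λ x → x * 1/ suc k ! * 1/ k !) (ι-* (suc k) (k !)) ⟨
  ι (suc k !) * 1/ suc k ! * 1/ k !               ≡⟨ cong (_* 1/ k !) (ι-1/! (suc k)) ⟩
  1ℚ * 1/ k !                                     ≡⟨ ℚ.*-identityˡ _ ⟩
  1/ k !                                          ∎
  where
  open ≡-Reasoning
  lemma : ∀ a b c d → a * b * (c * d) ≡ a * c * b * d
  lemma = solve-∀ ℚ-ring

^*1/!≤ : ∀ d k → ι (d ℕ.^ k) * 1/ k ! ≤ ι (d ℕ.^ d)
^*1/!≤ d k = begin
  ι (d ℕ.^ k) * 1/ k !               ≤⟨ ℚ.*-monoʳ-≤-nonNeg (1/ k !) {{ℚ.nonNegative (0≤1/! k)}} (ι-mono-≤ (^-≤-! d k)) ⟩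
  ι (d ℕ.^ d ℕ.* k !) * 1/ k !       ≡⟨ cong (_* 1/ k !) (ι-* (d ℕ.^ d) (k !)) ⟩
  ι (d ℕ.^ d) * ι (k !) * 1/ k !     ≡⟨ ℚ.*-assoc (ι (d ℕ.^ d)) (ι (k !)) (1/ k !) ⟩
  ι (d ℕ.^ d) * (ι (k !) * 1/ k !)   ≡⟨ cong (ι (d ℕ.^ d) *_) (ι-1/! k) ⟩
  ι (d ℕ.^ d) * 1ℚ                   ≡⟨ ℚ.*-identityʳ _ ⟩
  ι (d ℕ.^ d)                        ∎
  where open ℚ.≤-Reasoning

δℚ : ∀ {n} → Fin n → Fin n → ℚ
δℚ w u = if does (w Fin.≟ u) then 1ℚ else 0ℚ

δℚ-≢ : ∀ {n} {w u : Fin n} → w ≢ u → δℚ w u ≡ 0ℚ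
δℚ-≢ {w = w} {u} w≢u with w Fin.≟ u
... | yes w≡u = contradiction w≡u w≢u
... | no _    = refl

sum-zero : ∀ {n} (f : Vector ℚ n) → (∀ i → f i ≡ 0ℚ) → sum f ≡ 0ℚ
sum-zero {n} f f≡0 = trans (sum-cong-≗ f≡0) (sum-replicate-zero n)

sum-δ : ∀ {n} (u : Fin n) (x : Vector ℚ n) → sum (λ w → δℚ w u * x w) ≡ x u
sum-δ zero    x = trans (cong (1ℚ * x zero +_) (sum-zero (λ w → 0ℚ * x (suc w)) (λ w → ℚ.*-zeroˡ (x (suc w))))) (lemma (x zero))
  where
  lemma : ∀ a → 1ℚ * a + 0ℚ ≡ a
  lemma = solve-∀ ℚ-ring
sum-δ (suc u) x = trans (cong (0ℚ * x zero +_) (sum-δ u (x ∘ suc))) (lemma (x zero) (x (suc u)))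
  where
  lemma : ∀ a b → 0ℚ * a + b ≡ b
  lemma = solve-∀ ℚ-ring

sum-neg : ∀ {n} (f : Vector ℚ n) → sum (λ i → - f i) ≡ - sum f
sum-neg {zero}  f = refl
sum-neg {suc n} f = trans (cong (- f zero +_) (sum-neg (f ∘ suc))) (sym (ℚ.neg-distrib-+ (f zero) _))

sum-* : ∀ {m n} (f : Vector ℚ m) (g : Vector ℚ n) → sum f * sum g ≡ sum λ i → sum λ j → f i * g j
sum-* f g = trans (*-distribʳ-sum (sum g) f) (sum-cong-≗ λ i → *-distribˡ-sum (f i) g)

power : ∀ {n} → (Fin n → Fin n → ℚ) → ℕ → Fin n → Fin n → ℚ
power K zero    w u = δℚ w u
power K (suc k) w u = sum λ w′ → K w w′ * power K k w′ u

expPartial : ∀ {n} → (Fin n → Fin n → ℚ) → ℕ → Fin n → Fin n → ℚ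
expPartial K m w u = ∑ m λ k → 1/ k ! * power K k w u

power-bound : ∀ {n} K M → (∀ w u → ∣ K w u ∣ ≤ ι M) →
              ∀ k (w u : Fin n) → ∣ power K k w u ∣ ≤ ι ((n ℕ.* M) ℕ.^ k)
power-bound K M K≤M zero w u with does (w Fin.≟ u)
... | true  = ℚ.≤-refl
... | false = 0≤1
power-bound {n} K M K≤M (suc k) w u = subst (_ ≤_) eq
  (∣sum∣≤ (λ w′ → K w w′ * power K k w′ u)
    (λ w′ → ∣p*q∣≤ {K w w′} (K≤M w w′) (power-bound K M K≤M k w′ u)))
  where
  Q^k = (n ℕ.* M) ℕ.^ k
  eq : ι n * (ι M * ι Q^k) ≡ ι (n ℕ.* M ℕ.* Q^k)
  eq = trans (sym (ℚ.*-assoc (ι n) (ι M) (ι Q^k)))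
    (trans (cong (_* ι Q^k) (sym (ι-* n M))) (sym (ι-* (n ℕ.* M) Q^k)))

module Orthogonality {n} (K : Fin n → Fin n → ℚ) (skew : ∀ w u → K w u ≡ - K u w)
                     {u v : Fin n} (u≢v : u ≢ v) where

  -- The inner product of `K^j e_u` and `K^k e_v`. By skew-symmetry it equals `(-1)^j` times the
  -- `(u, v)` entry of `K^(j+k)`.
  F : ℕ → ℕ → ℚ
  F j k = sum λ w → power K j w u * power K k w v

  F-skew : ∀ j k → F (suc j) k ≡ - F j (suc k)
  F-skew j k = begin
    sum (λ w → sum (λ w′ → K w w′ * x w′) * y w)
      ≡⟨ sum-cong-≗ (λ w → *-distribʳ-sum (y w) (λ w′ → K w w′ * x w′)) ⟩
    sum (λ w → sum (λ w′ → K w w′ * x w′ * y w))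
      ≡⟨ ∑-comm (λ w w′ → K w w′ * x w′ * y w) ⟩
    sum (λ w′ → sum (λ w → K w w′ * x w′ * y w))
      ≡⟨ sum-cong-≗ (λ w′ → sum-cong-≗ λ w → trans
           (cong (λ z → z * x w′ * y w) (skew w w′)) (lemma (K w′ w) (x w′) (y w))) ⟩
    sum (λ w′ → sum (λ w → - x w′ * (K w′ w * y w)))
      ≡⟨ sum-cong-≗ (λ w′ → sym (*-distribˡ-sum (- x w′) (λ w → K w′ w * y w))) ⟩
    sum (λ w′ → - x w′ * sum (λ w → K w′ w * y w))
      ≡⟨ sum-cong-≗ (λ w′ → sym (ℚ.neg-distribˡ-* (x w′) _)) ⟩
    sum (λ w′ → - (x w′ * sum (λ w → K w′ w * y w)))
      ≡⟨ sum-neg (λ w′ → x w′ * sum (λ w → K w′ w * y w)) ⟩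
    - sum (λ w′ → x w′ * sum (λ w → K w′ w * y w)) ∎
    where
    open ≡-Reasoning
    x = λ w → power K j w u
    y = λ w → power K k w v
    lemma : ∀ a b c → - a * b * c ≡ - b * (a * c)
    lemma = solve-∀ ℚ-ring

  -- Moving every factor `K` to the side of `v` leaves a single entry of a power; estimating the sum
  -- over `w` termwise would cost a further factor `n`.
  F-bound : ∀ M → (∀ w u → ∣ K w u ∣ ≤ ι M) → ∀ j k → ∣ F j k ∣ ≤ ι ((n ℕ.* M) ℕ.^ (j ℕ.+ k))
  F-bound M K≤M zero    k = subst (λ x → ∣ x ∣ ≤ _) (sym (sum-δ u (λ w → power K k w v)))
    (power-bound K M K≤M k u v)
  F-bound M K≤M (suc j) k = subst₂ _≤_
    (trans (sym (ℚ.∣-p∣≡∣p∣ (F j (suc k)))) (cong ∣_∣ (sym (F-skew j k))))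
    (cong (λ l → ι ((n ℕ.* M) ℕ.^ l)) (ℕ.+-suc j k))
    (F-bound M K≤M j (suc k))

  f : ℕ → ℕ → ℚ
  f j k = 1/ j ! * 1/ k ! * F j k

  -- Along `j + k = l` the terms `f j k` are, up to a common factor, the signed binomial
  -- coefficients of `(1 - 1)^l`. This relation between neighbours is the form in which `diagonal≡0`
  -- uses that fact.
  f-skew : ∀ j k → ι (suc j) * f (suc j) k ≡ - (ι (suc k) * f j (suc k))
  f-skew j k = begin
    ι (suc j) * (1/ suc j ! * 1/ k ! * F (suc j) k)
      ≡⟨ pull₁ (ι (suc j)) (1/ suc j !) (1/ k !) (F (suc j) k) ⟩
    (ι (suc j) * 1/ suc j !) * 1/ k ! * F (suc j) k
      ≡⟨ cong₂ (λ x y → x * y * F (suc j) k) (1/!-suc j) (sym (1/!-suc k)) ⟩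
    1/ j ! * (ι (suc k) * 1/ suc k !) * F (suc j) k
      ≡⟨ cong (1/ j ! * (ι (suc k) * 1/ suc k !) *_) (F-skew j k) ⟩
    1/ j ! * (ι (suc k) * 1/ suc k !) * - F j (suc k)
      ≡⟨ pull₂ (ι (suc k)) (1/ j !) (1/ suc k !) (F j (suc k)) ⟩
    - (ι (suc k) * (1/ j ! * 1/ suc k ! * F j (suc k))) ∎
    where
    open ≡-Reasoning
    pull₁ : ∀ a b c d → a * (b * c * d) ≡ a * b * c * d
    pull₁ = solve-∀ ℚ-ring
    pull₂ : ∀ a b c d → b * (a * c) * - d ≡ - (a * (b * c * d))
    pull₂ = solve-∀ ℚ-ring

  -- Here the columns have to be distinct: for equal ones the corner would be 1, while the other
  -- antidiagonals vanish in either case.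
  f00≡0 : f 0 0 ≡ 0ℚ
  f00≡0 = cong (1/ 0 ! * 1/ 0 ! *_) (trans (sum-δ u (λ w → δℚ w v)) (δℚ-≢ u≢v))

  inner-expPartial : ∀ m → sum (λ w → expPartial K m w u * expPartial K m w v) ≡ ∑ m λ j → ∑ m (f j)
  inner-expPartial m = begin
    sum (λ w → expPartial K m w u * expPartial K m w v)
      ≡⟨ sum-cong-≗ (λ w → sum-* (x w) (y w)) ⟩
    sum (λ w → sum λ i → sum λ j → x w i * y w j)
      ≡⟨ ∑-comm (λ w i → sum λ j → x w i * y w j) ⟩
    sum (λ i → sum λ w → sum λ j → x w i * y w j)
      ≡⟨ sum-cong-≗ (λ i → ∑-comm (λ w j → x w i * y w j)) ⟩
    sum (λ i → sum λ j → sum λ w → x w i * y w j)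
      ≡⟨ sum-cong-≗ {m} (λ i → sum-cong-≗ {m} (term i)) ⟩
    ∑ m (λ j → ∑ m (f j)) ∎
    where
    open ≡-Reasoning
    x y : Fin n → Vector ℚ m
    x w i = 1/ toℕ i ! * power K (toℕ i) w u
    y w i = 1/ toℕ i ! * power K (toℕ i) w v
    regroup : ∀ a b c d → (a * b) * (c * d) ≡ (a * c) * (b * d)
    regroup = solve-∀ ℚ-ring
    term : ∀ i j → sum (λ w → x w i * y w j) ≡ f (toℕ i) (toℕ j)
    term i j = trans
      (sum-cong-≗ λ w → regroup (1/ toℕ i !) (power K (toℕ i) w u) (1/ toℕ j !) (power K (toℕ j) w v))
      (sym (*-distribˡ-sum (1/ toℕ i ! * 1/ toℕ j !) (λ w → power K (toℕ i) w u * power K (toℕ j) w v)))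

module _ {n : ℕ} (M : ℕ) where
  private
    Q = n ℕ.* M
    d = 8 ℕ.* Q
    D = ι (d ℕ.^ d)

  -- Since `d = 8 Q`, the product `8^(j+k) Q^(j+k)` splits as `d^j d^k`, and each power is absorbed
  -- by its own factorial at the cost of one factor `D`.
  f-bound : ∀ K skew {u v : Fin n} (u≢v : u ≢ v) → (∀ w u → ∣ K w u ∣ ≤ ι M) →
            ∀ m j k → m ℕ.≤ j ℕ.+ k → ι (8 ℕ.^ m) * ∣ Orthogonality.f K skew u≢v j k ∣ ≤ D * D
  f-bound K skew u≢v K≤M m j k m≤j+k = begin
    ι (8 ℕ.^ m) * ∣ 1/ j ! * 1/ k ! * F j k ∣
      ≡⟨ cong (ι (8 ℕ.^ m) *_) (trans (ℚ.∣p*q∣≡∣p∣*∣q∣ (1/ j ! * 1/ k !) (F j k))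
           (cong (_* ∣ F j k ∣) (ℚ.0≤p⇒∣p∣≡p 0≤c))) ⟩
    ι (8 ℕ.^ m) * (1/ j ! * 1/ k ! * ∣ F j k ∣)
      ≤⟨ *-mono-≤ (0≤ι (8 ℕ.^ (j ℕ.+ k))) (*-nonNeg 0≤c (ℚ.0≤∣p∣ (F j k)))
           (ι-mono-≤ (ℕ.^-monoʳ-≤ 8 m≤j+k)) (*-monoˡ-≤ 0≤c (F-bound M K≤M j k)) ⟩
    ι (8 ℕ.^ (j ℕ.+ k)) * (1/ j ! * 1/ k ! * ι (Q ℕ.^ (j ℕ.+ k)))
      ≡⟨ swap (ι (8 ℕ.^ (j ℕ.+ k))) (1/ j ! * 1/ k !) (ι (Q ℕ.^ (j ℕ.+ k))) ⟩
    ι (8 ℕ.^ (j ℕ.+ k)) * ι (Q ℕ.^ (j ℕ.+ k)) * (1/ j ! * 1/ k !)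
      ≡⟨ cong (_* (1/ j ! * 1/ k !)) powers ⟩
    ι (d ℕ.^ j) * ι (d ℕ.^ k) * (1/ j ! * 1/ k !)
      ≡⟨ regroup (ι (d ℕ.^ j)) (ι (d ℕ.^ k)) (1/ j !) (1/ k !) ⟩
    (ι (d ℕ.^ j) * 1/ j !) * (ι (d ℕ.^ k) * 1/ k !)
      ≤⟨ *-mono-≤ (0≤ι (d ℕ.^ d)) (*-nonNeg (0≤ι (d ℕ.^ k)) (0≤1/! k)) (^*1/!≤ d j) (^*1/!≤ d k) ⟩
    D * D ∎
    where
    open Orthogonality K skew u≢v
    open ℚ.≤-Reasoning
    0≤c : 0ℚ ≤ 1/ j ! * 1/ k !
    0≤c = *-nonNeg (0≤1/! j) (0≤1/! k)
    swap : ∀ a b c → a * (b * c) ≡ a * c * b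
    swap = solve-∀ ℚ-ring
    regroup : ∀ a b c d → (a * b) * (c * d) ≡ (a * c) * (b * d)
    regroup = solve-∀ ℚ-ring
    powers : ι (8 ℕ.^ (j ℕ.+ k)) * ι (Q ℕ.^ (j ℕ.+ k)) ≡ ι (d ℕ.^ j) * ι (d ℕ.^ k)
    powers = trans (sym (ι-* (8 ℕ.^ (j ℕ.+ k)) (Q ℕ.^ (j ℕ.+ k)))) (trans
      (cong ι (trans (sym (^-distribʳ-* (j ℕ.+ k) 8 Q)) (ℕ.^-distribˡ-+-* d j k)))
      (ι-* (d ℕ.^ j) (d ℕ.^ k)))

  -- The antidiagonals of ∑∑ F j k / (j! k!) cancel; what is left has at most
  -- m² terms, each at most D² / 8ᵐ.
  expPartial-orthogonal : ∀ {ε} → 0ℚ < ε → ∃[ m₀ ] ∀ m → m₀ ℕ.≤ m →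
    ∀ K → (∀ w u → K w u ≡ - K u w) → (∀ w u → ∣ K w u ∣ ≤ ι M) →
    ∀ {u v : Fin n} → u ≢ v → ∣ sum (λ w → expPartial K m w u * expPartial K m w v) ∣ ≤ ε
  expPartial-orthogonal {ε} 0<ε = suc m₁ , small
    where
    m₁ = proj₁ (archimedean-* (D * D) 0<ε)
    small : ∀ m → suc m₁ ℕ.≤ m → ∀ K → (∀ w u → K w u ≡ - K u w) → (∀ w u → ∣ K w u ∣ ≤ ι M) →
      ∀ {u v : Fin n} → u ≢ v → ∣ sum (λ w → expPartial K m w u * expPartial K m w v) ∣ ≤ ε
    -- Both sides are multiplied by `m`: the left one is then at most `m³ D² / 8^m`, hence at most
    -- `D²`, and `m₁` is chosen with `D² ≤ m₁ ε`.
    small m@(suc _) m₁<m K skew K≤M u≢v = *-cancelˡ-≤ (0<ι m) (begin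
      ι m * ∣ sum (λ w → expPartial K m w _ * expPartial K m w _) ∣
        ≡⟨ cong (λ x → ι m * ∣ x ∣) (trans (inner-expPartial m) (sym (trans
             (cong (λ x → ∑ m (λ j → ∑ m (f j)) - x) (triangle≡0 f (diagonal≡0 f f00≡0 f-skew) m))
             (ℚ.+-identityʳ _)))) ⟩
      ι m * ∣ ∑ m (λ j → ∑ m (f j)) - triangle f m ∣
        ≤⟨ *-monoˡ-≤ (0≤ι m) (square-triangle f 0≤C ℕ.≤-refl f≤C) ⟩
      ι m * (ι m * (ι m * C))
        ≡⟨ regroup (ι m) i (D * D) ⟩
      ι m * ι m * ι m * (i * (D * D))
        ≤⟨ ℚ.*-monoʳ-≤-nonNeg C {{ℚ.nonNegative 0≤C}} cubes ⟩
      ι (8 ℕ.^ m) * (i * (D * D))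
        ≡⟨ ℚ.*-assoc (ι (8 ℕ.^ m)) i (D * D) ⟨
      ι (8 ℕ.^ m) * i * (D * D)
        ≡⟨ cong (_* (D * D)) 8^m*i≡1 ⟩
      1ℚ * (D * D)
        ≡⟨ ℚ.*-identityˡ _ ⟩
      D * D
        ≤⟨ proj₂ (archimedean-* (D * D) 0<ε) ⟩
      ι m₁ * ε
        ≤⟨ ℚ.*-monoʳ-≤-nonNeg ε {{ℚ.nonNegative (ℚ.<⇒≤ 0<ε)}} (ι-mono-≤ (ℕ.<⇒≤ m₁<m)) ⟩
      ι m * ε ∎)
      where
      open Orthogonality K skew u≢v
      open ℚ.≤-Reasoning
      instance
        8^m≢0 : ℕ.NonZero (8 ℕ.^ m)
        8^m≢0 = ℕ.m^n≢0 8 m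
      i = inv (8 ℕ.^ m)
      8^m*i≡1 : ι (8 ℕ.^ m) * i ≡ 1ℚ
      8^m*i≡1 = ι-inv (8 ℕ.^ m)
      C = i * (D * D)
      0≤C : 0ℚ ≤ C
      0≤C = *-nonNeg (ℚ.<⇒≤ (0<inv (8 ℕ.^ m))) (*-nonNeg (0≤ι (d ℕ.^ d)) (0≤ι (d ℕ.^ d)))
      regroup : ∀ m i x → m * (m * (m * (i * x))) ≡ m * m * m * (i * x)
      regroup = solve-∀ ℚ-ring
      cubes : ι m * ι m * ι m ≤ ι (8 ℕ.^ m)
      cubes = subst (_≤ ι (8 ℕ.^ m)) (trans (ι-* (m ℕ.* m) m) (cong (_* ι m) (ι-* m m))) (ι-mono-≤ (n³≤8^n m))
      f≤C : ∀ j k → m ℕ.≤ j ℕ.+ k → ∣ f j k ∣ ≤ C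
      f≤C j k m≤j+k = *-cancelˡ-≤ (0<ι (8 ℕ.^ m)) (subst (_ ≤_)
        (sym (trans (sym (ℚ.*-assoc (ι (8 ℕ.^ m)) i (D * D))) (trans (cong (_* (D * D)) 8^m*i≡1) (ℚ.*-identityˡ (D * D)))))
        (f-bound K skew u≢v K≤M m j k m≤j+k))

-- Almost flat rational vectors

sq-cancel-≤ : ∀ {x y} → 0ℚ ≤ y → x * x ≤ y * y → x ≤ y
sq-cancel-≤ {x} {y} 0≤y xx≤yy with x ℚ.≤? y
... | yes x≤y = x≤y
... | no  x≰y = contradiction (ℚ.<-≤-trans yy<xx xx≤yy) (ℚ.<-irrefl refl)
  where
  y<x : y < x
  y<x = ℚ.≰⇒> x≰y
  yy<xx : y * y < x * x
  yy<xx = ℚ.≤-<-trans (*-monoˡ-≤ 0≤y (ℚ.<⇒≤ y<x))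
    (ℚ.*-monoˡ-<-pos x {{ℚ.positive (ℚ.≤-<-trans 0≤y y<x)}} y<x)

∣p∣*∣p∣≡p*p : ∀ p → ∣ p ∣ * ∣ p ∣ ≡ p * p
∣p∣*∣p∣≡p*p p with ℚ.∣p∣≡p∨∣p∣≡-p p
... | inj₁ eq = cong₂ _*_ eq eq
... | inj₂ eq = trans (cong₂ _*_ eq eq) (lemma p)
  where
  lemma : ∀ p → - p * - p ≡ p * p
  lemma = solve-∀ ℚ-ring

0≤p*p : ∀ p → 0ℚ ≤ p * p
0≤p*p p = subst (0ℚ ≤_) (∣p∣*∣p∣≡p*p p) (*-nonNeg (ℚ.0≤∣p∣ p) (ℚ.0≤∣p∣ p))

≤-from-difference : ∀ {p q r} → 0ℚ ≤ r → q - p ≡ r → p ≤ q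
≤-from-difference {p} {q} {r} 0≤r eq = subst₂ _≤_ (ℚ.+-identityʳ p)
  (trans (cong (p +_) (sym eq)) (lemma p q)) (ℚ.+-monoʳ-≤ p 0≤r)
  where
  lemma : ∀ p q → p + (q - p) ≡ q
  lemma = solve-∀ ℚ-ring

difference-nonNeg : ∀ {p q} → p ≤ q → 0ℚ ≤ q - p
difference-nonNeg {p} {q} p≤q = subst (_≤ q - p) (ℚ.+-inverseʳ p) (ℚ.+-monoˡ-≤ (- p) p≤q)

∣p-q∣≤⇒p≤ : ∀ p q {e} → ∣ p - q ∣ ≤ e → p ≤ q + e
∣p-q∣≤⇒p≤ p q {e} h = subst (_≤ q + e) (lemma p q)
  (ℚ.+-monoʳ-≤ q (ℚ.≤-trans (p≤∣p∣ (p - q)) h))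
  where
  lemma : ∀ p q → q + (p - q) ≡ p
  lemma = solve-∀ ℚ-ring

∣p-q∣≡∣q-p∣ : ∀ p q → ∣ p - q ∣ ≡ ∣ q - p ∣
∣p-q∣≡∣q-p∣ p q = trans (sym (ℚ.∣-p∣≡∣p∣ (p - q))) (cong ∣_∣ (lemma p q))
  where
  lemma : ∀ p q → - (p - q) ≡ q - p
  lemma = solve-∀ ℚ-ring

∣p-q∣≤⇒q≤ : ∀ p q {e} → ∣ p - q ∣ ≤ e → q - e ≤ p
∣p-q∣≤⇒q≤ p q {e} h = subst (q - e ≤_) (lemma p e)
  (ℚ.+-monoˡ-≤ (- e) (∣p-q∣≤⇒p≤ q p (subst (_≤ e) (∣p-q∣≡∣q-p∣ p q) h)))
  where
  lemma : ∀ p e → p + e - e ≡ p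
  lemma = solve-∀ ℚ-ring

sgn : Bool → ℚ
sgn true  = 1ℚ
sgn false = - 1ℚ

-- The witness `a` is the number of `true` values.
sum-sgn-parity : ∀ {n} (s : Fin n → Bool) → ∃[ a ] sum (λ i → sgn (s i)) + ι n ≡ ι a + ι a
sum-sgn-parity {zero}  s = 0 , refl
sum-sgn-parity {suc n} s with s zero | sum-sgn-parity (s ∘ suc)
... | true  | a , eq = suc a , trans (lemma₁ (sum (λ i → sgn (s (suc i)))) (ι n)) (trans (cong (λ x → 1ℚ + 1ℚ + x) eq) (lemma₂ (ι a)))
  where
  lemma₁ : ∀ x n → (1ℚ + x) + (1ℚ + n) ≡ 1ℚ + 1ℚ + (x + n)
  lemma₁ = solve-∀ ℚ-ring
  lemma₂ : ∀ a → 1ℚ + 1ℚ + (a + a) ≡ (1ℚ + a) + (1ℚ + a)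
  lemma₂ = solve-∀ ℚ-ring
... | false | a , eq = a , trans (lemma (sum (λ i → sgn (s (suc i)))) (ι n)) eq
  where
  lemma : ∀ x n → (- 1ℚ + x) + (1ℚ + n) ≡ x + n
  lemma = solve-∀ ℚ-ring

-- The sum is `2 a - (2 b + 1)`, where `a` counts the positive signs: at least 1 if `b < a`, at most
-- -1 if `a ≤ b`.
odd-sum-sgn : ∀ {n} b → n ≡ suc (b ℕ.+ b) → (s : Fin n → Bool) → 1ℚ ≤ ∣ sum (λ i → sgn (s i)) ∣
odd-sum-sgn b refl s with a , eq ← sum-sgn-parity s with ℕ.≤-<-connex a b
... | inj₂ b<a = ℚ.≤-trans
  (≤-from-difference (+-nonNeg 0≤d 0≤d) (trans (lemma₁ Σs (ι b)) (trans
     (cong (λ x → x - (1ℚ + ((1ℚ + ι b) + ι b))) (trans (cong (λ x → Σs + (1ℚ + x)) (sym (ι-+ b b))) eq))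
     (lemma₂ (ι b) (ι a)))))
  (p≤∣p∣ Σs)
  where
  Σs = sum (λ i → sgn (s i))
  0≤d : 0ℚ ≤ ι a - (1ℚ + ι b)
  0≤d = difference-nonNeg (ι-mono-≤ b<a)
  lemma₁ : ∀ x b → x - 1ℚ ≡ (x + (1ℚ + (b + b))) - (1ℚ + ((1ℚ + b) + b))
  lemma₁ = solve-∀ ℚ-ring
  lemma₂ : ∀ b a → (a + a) - (1ℚ + ((1ℚ + b) + b)) ≡ (a - (1ℚ + b)) + (a - (1ℚ + b))
  lemma₂ = solve-∀ ℚ-ring
... | inj₁ a≤b = ℚ.≤-trans
  (≤-from-difference (+-nonNeg 0≤d 0≤d) (trans (lemma₁ Σs (ι b)) (trans
     (cong (λ x → ι b + ι b - x) (trans (cong (λ x → Σs + (1ℚ + x)) (sym (ι-+ b b))) eq))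
     (lemma₂ (ι b) (ι a)))))
  (subst (- Σs ≤_) (ℚ.∣-p∣≡∣p∣ Σs) (p≤∣p∣ (- Σs)))
  where
  Σs = sum (λ i → sgn (s i))
  0≤d : 0ℚ ≤ ι b - ι a
  0≤d = difference-nonNeg (ι-mono-≤ a≤b)
  lemma₁ : ∀ x b → - x - 1ℚ ≡ b + b - (x + (1ℚ + (b + b)))
  lemma₁ = solve-∀ ℚ-ring
  lemma₂ : ∀ b a → b + b - (a + a) ≡ (b - a) + (b - a)
  lemma₂ = solve-∀ ℚ-ring

-- Comparing squares replaces taking roots: `(1 - β)² ≤ a b ≤ (1 + β)²`, where `β ≤ 1` keeps `1 - β`
-- nonnegative.
near-1 : ∀ x a b {β} → 0ℚ ≤ β → β ≤ 1ℚ → x * x ≡ a * b →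
         ∣ a - 1ℚ ∣ ≤ β → ∣ b - 1ℚ ∣ ≤ β → 0ℚ ≤ x → ∣ x - 1ℚ ∣ ≤ β
near-1 x a b {β} 0≤β β≤1 xx≡ab ha hb 0≤x = ∣p∣≤q
  (≤-from-difference (difference-nonNeg x≤1+β) (lemma₁ x β))
  (≤-from-difference (difference-nonNeg 1-β≤x) (lemma₂ x β))
  where
  lemma₁ : ∀ x β → β - (x - 1ℚ) ≡ (1ℚ + β) - x
  lemma₁ = solve-∀ ℚ-ring
  lemma₂ : ∀ x β → β - (- (x - 1ℚ)) ≡ x - (1ℚ - β)
  lemma₂ = solve-∀ ℚ-ring
  0≤1+β = +-nonNeg 0≤1 0≤β
  0≤1-β = difference-nonNeg β≤1
  x≤1+β : x ≤ 1ℚ + β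
  x≤1+β = sq-cancel-≤ 0≤1+β (subst (_≤ _) (sym xx≡ab)
    (*-mono-≤ 0≤1+β (ℚ.≤-trans 0≤1-β (∣p-q∣≤⇒q≤ b 1ℚ hb)) (∣p-q∣≤⇒p≤ a 1ℚ ha) (∣p-q∣≤⇒p≤ b 1ℚ hb)))
  1-β≤x : 1ℚ - β ≤ x
  1-β≤x = sq-cancel-≤ 0≤x (subst (_ ≤_) (sym xx≡ab)
    (*-mono-≤ (ℚ.≤-trans 0≤1-β (∣p-q∣≤⇒q≤ a 1ℚ ha)) 0≤1-β (∣p-q∣≤⇒q≤ a 1ℚ ha) (∣p-q∣≤⇒q≤ b 1ℚ hb)))

near-sgn : ∀ x a b {β} → 0ℚ ≤ β → β ≤ 1ℚ → x * x ≡ a * b →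
           ∣ a - 1ℚ ∣ ≤ β → ∣ b - 1ℚ ∣ ≤ β → ∃[ s ] ∣ x - sgn s ∣ ≤ β
near-sgn x a b {β} 0≤β β≤1 xx≡ab ha hb with ℚ.≤-total 0ℚ x
... | inj₁ 0≤x = true , near-1 x a b 0≤β β≤1 xx≡ab ha hb 0≤x
... | inj₂ x≤0 = false , subst (_≤ β) (trans (sym (ℚ.∣-p∣≡∣p∣ _)) (cong ∣_∣ (lemma₂ x)))
  (near-1 (- x) a b 0≤β β≤1 (trans (lemma₁ x) xx≡ab) ha hb (ℚ.neg-antimono-≤ x≤0))
  where
  lemma₁ : ∀ x → - x * - x ≡ x * x
  lemma₁ = solve-∀ ℚ-ring
  lemma₂ : ∀ x → - (- x - 1ℚ) ≡ x - - 1ℚ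
  lemma₂ = solve-∀ ℚ-ring

-- The error budget, with `β = n θ`: scaling the inner product by `n` contributes `β`, rounding the
-- `n` products to signs contributes `n β`. The signs would sum to at most `(1 + n) β < 1` in
-- absolute value, impossible for an odd number of them.
¬flat-orthogonal : ∀ {n} .{{_ : ℕ.NonZero n}} b → n ≡ suc (b ℕ.+ b) →
  ∀ {θ} → 0ℚ ≤ θ → (1ℚ + ι n) * (ι n * θ) < 1ℚ → (x y : Fin n → ℚ) →
  (∀ w → ∣ x w * x w - inv n ∣ ≤ θ) → (∀ w → ∣ y w * y w - inv n ∣ ≤ θ) →
  ¬ (∣ sum (λ w → x w * y w) ∣ ≤ θ)
¬flat-orthogonal {n} b n≡1+2b {θ} 0≤θ small x y hx hy h =
  ℚ.<-irrefl refl (ℚ.≤-<-trans (odd-sum-sgn b n≡1+2b s) (ℚ.≤-<-trans bound small))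
  where
  ν = ι n
  β = ν * θ
  0≤β : 0ℚ ≤ β
  0≤β = *-nonNeg (0≤ι n) 0≤θ
  β≤1 : β ≤ 1ℚ
  β≤1 = ℚ.≤-trans (≤-from-difference (*-nonNeg (0≤ι n) 0≤β) (lemma ν β)) (ℚ.<⇒≤ small)
    where
    lemma : ∀ ν β → (1ℚ + ν) * β - β ≡ ν * β
    lemma = solve-∀ ℚ-ring
  scale : ∀ p → ∣ p - inv n ∣ ≤ θ → ∣ ν * p - 1ℚ ∣ ≤ β
  scale p hp = subst (λ z → ∣ z ∣ ≤ β)
    (trans (lemma ν p (inv n)) (cong (λ z → ν * p - z) (ι-inv n)))
    (∣p*q∣≤ {ν} (ℚ.≤-reflexive (ℚ.0≤p⇒∣p∣≡p (0≤ι n))) hp)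
    where
    lemma : ∀ ν p i → ν * (p - i) ≡ ν * p - ν * i
    lemma = solve-∀ ℚ-ring
  squares : ∀ ν x y → (ν * (x * y)) * (ν * (x * y)) ≡ (ν * (x * x)) * (ν * (y * y))
  squares = solve-∀ ℚ-ring
  signs : ∀ w → ∃[ s ] ∣ ν * (x w * y w) - sgn s ∣ ≤ β
  signs w = near-sgn (ν * (x w * y w)) (ν * (x w * x w)) (ν * (y w * y w)) 0≤β β≤1 (squares ν (x w) (y w)) (scale (x w * x w) (hx w)) (scale (y w * y w) (hy w))
  s : Fin n → Bool
  s w = proj₁ (signs w)
  z t : Fin n → ℚ
  z w = ν * (x w * y w)
  t w = - (z w - sgn (s w))
  sum-split : sum (λ w → sgn (s w)) ≡ ν * sum (λ w → x w * y w) + sum t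
  sum-split = trans (sum-cong-≗ (λ w → lemma (z w) (sgn (s w))))
    (trans (∑-distrib-+ z t) (cong (_+ sum t) (sym (*-distribˡ-sum ν (λ w → x w * y w)))))
    where
    lemma : ∀ z s → s ≡ z + - (z - s)
    lemma = solve-∀ ℚ-ring
  bound : ∣ sum (λ w → sgn (s w)) ∣ ≤ (1ℚ + ν) * β
  bound = subst₂ _≤_ (cong ∣_∣ (sym sum-split)) (lemma ν β)
    (∣p+q∣≤ {ν * sum (λ w → x w * y w)}
      (∣p*q∣≤ {ν} (ℚ.≤-reflexive (ℚ.0≤p⇒∣p∣≡p (0≤ι n))) h)
      (∣sum∣≤ t (λ w → subst (_≤ β) (sym (ℚ.∣-p∣≡∣p∣ (z w - sgn (s w)))) (proj₂ (signs w)))))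
    where
    lemma : ∀ ν β → β + ν * β ≡ (1ℚ + ν) * β
    lemma = solve-∀ ℚ-ring

-- The constant 8 comes from `p² - i = (a² + b² - i) - b² + (p - a)² + 2 a (p -
-- a)`: the summands are at most `2 ε`, `ε²`, `ε²` and `4 ε`, the last because `a² ≤ i + 2 ε ≤
-- 3` gives `|a| ≤ 2`; and `ε² ≤ ε`.
flat-approx : ∀ a b p i {ε} → i ≤ 1ℚ → 0ℚ ≤ ε → ε ≤ 1ℚ →
  ∣ a - p ∣ ≤ ε → ∣ b ∣ ≤ ε → ∣ a * a + b * b - i ∣ ≤ ε + ε → ∣ p * p - i ∣ ≤ ι 8 * ε
flat-approx a b p i {ε} i≤1 0≤ε ε≤1 hap hb hab = ℚ.≤-trans
  (subst (λ z → ∣ z ∣ ≤ _) (expand a b p i)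
    (∣p+q∣≤ {(a * a + b * b - i) + - (b * b) + (p - a) * (p - a)}
      (∣p+q∣≤ {(a * a + b * b - i) + - (b * b)}
        (∣p+q∣≤ {a * a + b * b - i} hab
          (subst (_≤ ε * ε) (sym (ℚ.∣-p∣≡∣p∣ (b * b))) (∣p*q∣≤ {b} hb hb)))
        (∣p*q∣≤ {p - a} hpa hpa))
      (∣p*q∣≤ {a + a} (∣p+q∣≤ {a} ∣a∣≤2 ∣a∣≤2) hpa)))
  (≤-from-difference (+-nonNeg 0≤ε-εε 0≤ε-εε) (collect ε))
  where
  hpa : ∣ p - a ∣ ≤ ε
  hpa = subst (_≤ ε) (∣p-q∣≡∣q-p∣ a p) hap
  expand : ∀ a b p i → (a * a + b * b - i) + - (b * b) + (p - a) * (p - a) + (a + a) * (p - a) ≡ p * p - i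
  expand = solve-∀ ℚ-ring
  0≤ε-εε : 0ℚ ≤ ε - ε * ε
  0≤ε-εε = difference-nonNeg (subst (ε * ε ≤_) (ℚ.*-identityʳ ε) (*-monoˡ-≤ 0≤ε ε≤1))
  collect : ∀ ε → ι 8 * ε - (ε + ε + ε * ε + ε * ε + (ι 2 + ι 2) * ε) ≡ (ε - ε * ε) + (ε - ε * ε)
  collect = solve-∀ ℚ-ring
  aa≤4 : a * a ≤ ι 4
  aa≤4 = begin
    a * a           ≤⟨ ≤-from-difference (0≤p*p b) (lemma (a * a) (b * b)) ⟩
    a * a + b * b   ≤⟨ ∣p-q∣≤⇒p≤ (a * a + b * b) i hab ⟩
    i + (ε + ε)     ≤⟨ ℚ.+-mono-≤ i≤1 (ℚ.+-mono-≤ ε≤1 ε≤1) ⟩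
    ι 3             ≤⟨ ι-mono-≤ {3} {4} (ℕ.n≤1+n 3) ⟩
    ι 4             ∎
    where
    open ℚ.≤-Reasoning
    lemma : ∀ x y → (x + y) - x ≡ y
    lemma = solve-∀ ℚ-ring
  ∣a∣≤2 : ∣ a ∣ ≤ ι 2
  ∣a∣≤2 = sq-cancel-≤ (0≤ι 2) (subst (_≤ ι 4) (sym (∣p∣*∣p∣≡p*p a)) aa≤4)

term≤sum : ∀ {n} (f : Vector ℚ n) → (∀ i → 0ℚ ≤ f i) → ∀ i → f i ≤ sum f
term≤sum f 0≤f zero    = subst (_≤ sum f) (ℚ.+-identityʳ (f zero)) (ℚ.+-monoʳ-≤ (f zero) (sum-nonNeg (f ∘ suc) (0≤f ∘ suc)))
  where
  sum-nonNeg : ∀ {n} (f : Vector ℚ n) → (∀ i → 0ℚ ≤ f i) → 0ℚ ≤ sum f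
  sum-nonNeg {zero}  f 0≤f = ℚ.≤-refl
  sum-nonNeg {suc n} f 0≤f = +-nonNeg (0≤f zero) (sum-nonNeg (f ∘ suc) (0≤f ∘ suc))
term≤sum f 0≤f (suc i) = subst (_≤ sum f) (ℚ.+-identityˡ (f (suc i)))
  (ℚ.+-mono-≤ (0≤f zero) (term≤sum (f ∘ suc) (0≤f ∘ suc) i))

-- At a single index the representative of the norm may be slightly negative, and its square may
-- differ slightly from the sum; allowing for that costs a doubling of `ε`.
entry≤norm : ∀ {n} (x y : Vector ℚ n) {r ε} → 0ℚ ≤ ε → 0ℚ ≤ r + ε → r ≤ ε →
  ∣ r * r - sum (λ w → x w * x w + y w * y w) ∣ ≤ ε * ε → ∀ w → ∣ x w ∣ ≤ ε + ε
entry≤norm x y {r} {ε} 0≤ε -ε≤r r≤ε h w =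
  sq-cancel-≤ (+-nonNeg 0≤ε 0≤ε) (subst (_≤ _) (sym (∣p∣*∣p∣≡p*p (x w))) (begin
    x w * x w                             ≤⟨ ≤-from-difference (0≤p*p (y w)) (lemma₁ (x w * x w) (y w * y w)) ⟩
    x w * x w + y w * y w                 ≤⟨ term≤sum (λ w → x w * x w + y w * y w) (λ w → +-nonNeg (0≤p*p (x w)) (0≤p*p (y w))) w ⟩
    sum (λ w → x w * x w + y w * y w)     ≤⟨ ∣p-q∣≤⇒p≤ Σ (r * r) (subst (_≤ ε * ε) (∣p-q∣≡∣q-p∣ (r * r) Σ) h) ⟩
    r * r + ε * ε                         ≤⟨ ℚ.+-monoˡ-≤ (ε * ε) rr≤εε ⟩
    ε * ε + ε * ε                         ≤⟨ ≤-from-difference (+-nonNeg 0≤εε 0≤εε) (lemma₂ ε) ⟩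
    (ε + ε) * (ε + ε)                     ∎))
  where
  open ℚ.≤-Reasoning
  Σ = sum (λ w → x w * x w + y w * y w)
  0≤εε = *-nonNeg 0≤ε 0≤ε
  lemma₁ : ∀ x y → (x + y) - x ≡ y
  lemma₁ = solve-∀ ℚ-ring
  lemma₂ : ∀ ε → (ε + ε) * (ε + ε) - (ε * ε + ε * ε) ≡ ε * ε + ε * ε
  lemma₂ = solve-∀ ℚ-ring
  rr≤εε : r * r ≤ ε * ε
  rr≤εε = ≤-from-difference (*-nonNeg (difference-nonNeg r≤ε) -ε≤r) (lemma₃ r ε)
    where
    lemma₃ : ∀ r ε → ε * ε - r * r ≡ (ε - r) * (r + ε)
    lemma₃ = solve-∀ ℚ-ring

-- From real to rational matrices

Eventually-× : ∀ {P Q : ℕ → Set} → Eventually P → Eventually Q → Eventually λ n → P n × Q n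
Eventually-× (M , p) (N , q) = M ℕ.⊔ N , λ n h → p n (ℕ.m⊔n≤o⇒m≤o M N h) , q n (ℕ.m⊔n≤o⇒n≤o M N h)

Eventually-map : ∀ {P Q : ℕ → Set} → (∀ n → P n → Q n) → Eventually P → Eventually Q
Eventually-map f (N , p) = N , λ n h → f n (p n h)

Eventually-extract : ∀ {P : Set} → Eventually (λ _ → P) → P
Eventually-extract (N , p) = p N ℕ.≤-refl

Eventually-∀ : ∀ {n} {P : Fin n → ℕ → Set} → (∀ i → Eventually (P i)) → Eventually λ k → ∀ i → P i k
Eventually-∀ {zero}  ev = 0 , λ _ _ ()
Eventually-∀ {suc n} ev = Eventually-map
  (λ _ → λ { (p , _) zero → p ; (_ , ps) (suc i) → ps i })
  (Eventually-× (ev zero) (Eventually-∀ (ev ∘ suc)))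

Eventually-bounded : ∀ {n} {P : Fin n → ℕ → ℕ → Set} →
  (∀ i {M M′} j → M ℕ.≤ M′ → P i M j → P i M′ j) →
  (∀ i → ∃[ M ] Eventually (P i M)) → ∃[ M ] Eventually λ j → ∀ i → P i M j
Eventually-bounded {zero}  mono ev = 0 , 0 , λ _ _ ()
Eventually-bounded {suc n} mono ev =
  let M  , p  = ev zero
      M′ , ps = Eventually-bounded (mono ∘ suc) (ev ∘ suc)
  in M ℕ.⊔ M′ , Eventually-map
       (λ j → λ { (p , _) zero     → mono zero j (ℕ.m≤m⊔n M M′) p
                ; (_ , ps) (suc i) → mono (suc i) j (ℕ.m≤n⊔m M M′) (ps i) })
       (Eventually-× p ps)

seq-bounded : ∀ x → ∃[ M ] Eventually λ j → ∣ seq x j ∣ ≤ ι M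
seq-bounded x =
  let N , close = cauchy x 1ℚ (ℚ.positive⁻¹ 1ℚ)
      M , ≤M = archimedean (1ℚ + ∣ seq x N ∣)
  in M , N , λ j N≤j → ℚ.≤-trans
       (subst (λ z → ∣ z ∣ ≤ _) (lemma (seq x j) (seq x N))
         (∣p+q∣≤ {seq x j - seq x N} {seq x N} (close j N N≤j ℕ.≤-refl) ℚ.≤-refl))
       ≤M
  where
  lemma : ∀ a b → a - b + b ≡ a
  lemma = solve-∀ ℚ-ring

within : ∀ {l x ε} → l -ℝ fromℚ ε <ℝ x → x <ℝ l +ℝ fromℚ ε →
         Eventually λ j → ∣ seq l j - seq x j ∣ ≤ ε
within {l} {x} {ε} (δ₁ , 0<δ₁ , lower) (δ₂ , 0<δ₂ , upper) = Eventually-map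
  (λ j (lo , up) → ∣p∣≤q
    (≤-from-difference (+-nonNeg (difference-nonNeg lo) (ℚ.<⇒≤ 0<δ₁)) (lemma₁ (seq l j) (seq x j) ε δ₁))
    (≤-from-difference (+-nonNeg (difference-nonNeg up) (ℚ.<⇒≤ 0<δ₂)) (lemma₂ (seq l j) (seq x j) ε δ₂)))
  (Eventually-× lower upper)
  where
  lemma₁ : ∀ l x ε d → ε - (l - x) ≡ (x - (l - ε + d)) + d
  lemma₁ = solve-∀ ℚ-ring
  lemma₂ : ∀ l x ε d → ε - (- (l - x)) ≡ (l + ε - (x + d)) + d
  lemma₂ = solve-∀ ℚ-ring

0<fromℚ : ∀ {ε} → 0ℚ < ε → 0ℝ <ℝ fromℚ ε
0<fromℚ {ε} 0<ε = ε , 0<ε , 0 , λ _ _ → ℚ.≤-reflexive (ℚ.+-identityˡ ε)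

-- For each `m` the comparison of reals holds from an index `j` of its own; hence the nested
-- `Eventually` here and below.
⟶ᶜ-close : ∀ z l {ε} → 0ℚ < ε → z ⟶ᶜ l → Eventually λ m → Eventually λ j →
  ∣ seq (re l) j - seq (re (z m)) j ∣ ≤ ε × ∣ seq (im l) j - seq (im (z m)) j ∣ ≤ ε
⟶ᶜ-close z l {ε} 0<ε (re⟶ , im⟶) = Eventually-map
  (λ m ((re> , re<) , (im> , im<)) → Eventually-×
    (within {re l} {re (z m)} re> re<) (within {im l} {im (z m)} im> im<))
  (Eventually-× (re⟶ (fromℚ ε) (0<fromℚ 0<ε)) (im⟶ (fromℚ ε) (0<fromℚ 0<ε)))

seq-sumℝ : ∀ {n} (f : Vector ℝ n) j → seq (sumℝ f) j ≡ sum λ i → seq (f i) j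
seq-sumℝ {zero}  f j = refl
seq-sumℝ {suc n} f j = cong (seq (f zero) j +_) (seq-sumℝ (f ∘ suc) j)

seq-re-sumℂ : ∀ {n} (f : Vector ℂ n) j → seq (re (sumℂ f)) j ≡ sum λ i → seq (re (f i)) j
seq-re-sumℂ {zero}  f j = refl
seq-re-sumℂ {suc n} f j = cong (seq (re (f zero)) j +_) (seq-re-sumℂ (f ∘ suc) j)

seq-im-sumℂ : ∀ {n} (f : Vector ℂ n) j → seq (im (sumℂ f)) j ≡ sum λ i → seq (im (f i)) j
seq-im-sumℂ {zero}  f j = refl
seq-im-sumℂ {suc n} f j = cong (seq (im (f zero)) j +_) (seq-im-sumℂ (f ∘ suc) j)

seq-re-δ : ∀ {n} (u v : Fin n) j → seq (re (δ u v)) j ≡ δℚ v u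
seq-re-δ u v j with u Fin.≟ v | v Fin.≟ u
... | yes _   | yes _   = refl
... | yes u≡v | no v≢u  = contradiction (sym u≡v) v≢u
... | no u≢v  | yes v≡u = contradiction (sym v≡u) u≢v
... | no _    | no _    = refl

seq-im-δ : ∀ {n} (u v : Fin n) j → seq (im (δ u v)) j ≡ 0ℚ
seq-im-δ u v j with does (u Fin.≟ v)
... | true  = refl
... | false = refl

re-column : ∀ {n} (U : Matrix ℂ n) u w j → seq (re ((U ·ⱽ 𝐞 u) w)) j ≡ seq (re (U w u)) j
re-column U u w j = trans (seq-re-sumℂ (λ v → U w v *ᶜ 𝐞 u v) j)
  (trans (sum-cong-≗ term) (sum-δ u (λ v → seq (re (U w v)) j)))
  where
  lemma : ∀ a d b → a * d - b * 0ℚ ≡ d * a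
  lemma = solve-∀ ℚ-ring
  term : ∀ v → seq (re (U w v *ᶜ 𝐞 u v)) j ≡ δℚ v u * seq (re (U w v)) j
  term v = trans
    (cong₂ (λ x y → seq (re (U w v)) j * x - seq (im (U w v)) j * y) (seq-re-δ u v j) (seq-im-δ u v j))
    (lemma (seq (re (U w v)) j) (δℚ v u) (seq (im (U w v)) j))

im-column : ∀ {n} (U : Matrix ℂ n) u w j → seq (im ((U ·ⱽ 𝐞 u) w)) j ≡ seq (im (U w u)) j
im-column U u w j = trans (seq-im-sumℂ (λ v → U w v *ᶜ 𝐞 u v) j)
  (trans (sum-cong-≗ term) (sum-δ u (λ v → seq (im (U w v)) j)))
  where
  lemma : ∀ a d b → a * 0ℚ + b * d ≡ d * b
  lemma = solve-∀ ℚ-ring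
  term : ∀ v → seq (im (U w v *ᶜ 𝐞 u v)) j ≡ δℚ v u * seq (im (U w v)) j
  term v = trans
    (cong₂ (λ x y → seq (re (U w v)) j * y + seq (im (U w v)) j * x) (seq-re-δ u v j) (seq-im-δ u v j))
    (lemma (seq (re (U w v)) j) (δℚ v u) (seq (im (U w v)) j))

re-deviation : ∀ {n} .{{_ : ℕ.NonZero n}} (U : Matrix ℂ n) u w j →
  seq (re ((((U ·ⱽ 𝐞 u) ∘ⱽ (conjᴹ U ·ⱽ 𝐞 u)) -ⱽ uniform) w)) j ≡
  seq (re (U w u)) j * seq (re (U w u)) j + seq (im (U w u)) j * seq (im (U w u)) j - inv n
re-deviation {n} U u w j = trans
  (cong₂ (λ x y → x - y - inv n)
    (cong₂ _*_ (re-column U u w j) (re-column (conjᴹ U) u w j))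
    (cong₂ _*_ (im-column U u w j) (im-column (conjᴹ U) u w j)))
  (lemma (seq (re (U w u)) j) (seq (im (U w u)) j) (inv n))
  where
  lemma : ∀ a b i → a * a - b * - b - i ≡ a * a + b * b - i
  lemma = solve-∀ ℚ-ring

norm-small : ∀ {n} .{{_ : ℕ.NonZero n}} (U : Matrix ℂ n) u {r ε} → 0ℚ < ε →
  r IsNormOf (((U ·ⱽ 𝐞 u) ∘ⱽ (conjᴹ U ·ⱽ 𝐞 u)) -ⱽ uniform) → r <ℝ fromℚ ε →
  Eventually λ j → ∀ w →
    ∣ seq (re (U w u)) j * seq (re (U w u)) j + seq (im (U w u)) j * seq (im (U w u)) j - inv n ∣ ≤ ε + ε
norm-small {n} U u {r} {ε} 0<ε (0≤r , rr≈) (d , 0<d , r<ε) = Eventually-map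
  (λ j (-ε≤r , close , r+d≤ε) w → subst (λ z → ∣ z ∣ ≤ ε + ε) (re-deviation U u w j)
    (entry≤norm (λ w → seq (re ((((U ·ⱽ 𝐞 u) ∘ⱽ (conjᴹ U ·ⱽ 𝐞 u)) -ⱽ uniform) w)) j)
      (λ w → seq (im ((((U ·ⱽ 𝐞 u) ∘ⱽ (conjᴹ U ·ⱽ 𝐞 u)) -ⱽ uniform) w)) j)
      0≤ε -ε≤r
      (≤-from-difference (+-nonNeg (difference-nonNeg r+d≤ε) (ℚ.<⇒≤ 0<d)) (lemma (seq r j) ε d))
      (subst (λ z → ∣ seq r j * seq r j - z ∣ ≤ ε * ε)
        (seq-sumℝ (λ w → ∣ (((U ·ⱽ 𝐞 u) ∘ⱽ (conjᴹ U ·ⱽ 𝐞 u)) -ⱽ uniform) w ∣²) j) close)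
      w))
  (Eventually-× (0≤r ε 0<ε) (Eventually-× (rr≈ (ε * ε) 0<εε) r<ε))
  where
  0≤ε = ℚ.<⇒≤ 0<ε
  0<εε : 0ℚ < ε * ε
  0<εε = ℚ.positive⁻¹ (ε * ε) {{ℚ.pos*pos⇒pos ε {{ℚ.positive 0<ε}} ε {{ℚ.positive 0<ε}}}}
  lemma : ∀ r ε d → ε - r ≡ (ε - (r + d)) + d
  lemma = solve-∀ ℚ-ring

inv≤1 : ∀ n .{{_ : ℕ.NonZero n}} → inv n ≤ 1ℚ
inv≤1 n@(suc k) = subst₂ _≤_ (ℚ.*-identityˡ (inv n)) (ι-inv n)
  (ℚ.*-monoʳ-≤-nonNeg (inv n) {{ℚ.nonNegative (ℚ.<⇒≤ (0<inv n))}} (ι-mono-≤ {1} {n} (ℕ.s≤s ℕ.z≤n)))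

ι*inv<1 : ∀ k → ι k * inv (suc k) < 1ℚ
ι*inv<1 k = subst₂ _<_ (ℚ.+-identityˡ _) (trans (lemma (ι k) (inv (suc k))) (ι-inv (suc k)))
  (ℚ.+-monoˡ-< (ι k * inv (suc k)) (0<inv (suc k)))
  where
  lemma : ∀ k i → i + k * i ≡ (1ℚ + k) * i
  lemma = solve-∀ ℚ-ring

p-0*q≡p : ∀ p q → p - 0ℚ * q ≡ p
p-0*q≡p = solve-∀ ℚ-ring

-- Bipartite graphs

module Bipartite {n} (A : Matrix ℝ n) (χ : Fin n → Bool)
  (A-sym : ∀ u v j → seq (A u v) j ≡ seq (A v u) j)
  (A-bip : ∀ u v j → χ u ≡ χ v → seq (A u v) j ≡ 0ℚ) where

  -- The real and imaginary parts of the diagonal entries of the matrix that conjugates `iτA` into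
  -- `K`.
  χ⁺ χ⁻ : Fin n → ℚ
  χ⁺ w = if χ w then 1ℚ else 0ℚ
  χ⁻ w = if χ w then 0ℚ else 1ℚ

  -- iτA conjugated by the diagonal matrix with entries 1 where χ is true
  -- and i where χ is false, at the j-th approximation.
  K : ℝ → ℕ → Fin n → Fin n → ℚ
  K τ j w u = if χ w then - (seq τ j * seq (A w u) j) else seq τ j * seq (A w u) j

  -- Exact at each index, because symmetry and bipartiteness are assumed of every approximation of
  -- `A` and not merely up to `_≈_`.
  K-skew : ∀ τ j w u → K τ j w u ≡ - K τ j u w
  K-skew τ j w u with χ w in χw | χ u in χu
  ... | true | true rewrite A-bip w u j (trans χw (sym χu)) | A-bip u w j (trans χu (sym χw)) = lemma (seq τ j)
    where
    lemma : ∀ t → - (t * 0ℚ) ≡ - - (t * 0ℚ)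
    lemma = solve-∀ ℚ-ring
  ... | true | false rewrite A-sym w u j = refl
  ... | false | true rewrite A-sym w u j = lemma (seq τ j * seq (A u w) j)
    where
    lemma : ∀ t → t ≡ - - t
    lemma = solve-∀ ℚ-ring
  ... | false | false rewrite A-bip w u j (trans χw (sym χu)) | A-bip u w j (trans χu (sym χw)) = lemma (seq τ j)
    where
    lemma : ∀ t → t * 0ℚ ≡ - (t * 0ℚ)
    lemma = solve-∀ ℚ-ring

  K-bounded : ∀ τ → ∃[ M ] Eventually λ j → ∀ w u → ∣ K τ j w u ∣ ≤ ι M
  K-bounded τ = Eventually-bounded (λ w j M≤M′ h u → ℚ.≤-trans (h u) (ι-mono-≤ M≤M′)) λ w →
                Eventually-bounded (λ u j M≤M′ h → ℚ.≤-trans h (ι-mono-≤ M≤M′)) λ u →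
                let M , ev = seq-bounded (τ *ℝ A w u) in M , Eventually-map (bound w u M) ev
    where
    bound : ∀ w u M j → ∣ seq τ j * seq (A w u) j ∣ ≤ ι M → ∣ K τ j w u ∣ ≤ ι M
    bound w u M j h with χ w
    ... | true  = subst (_≤ ι M) (sym (ℚ.∣-p∣≡∣p∣ (seq τ j * seq (A w u) j))) h
    ... | false = h

  -- With D the diagonal matrix of entries `χ⁺ + i χ⁻`, this and `im-term` are the real and
  -- imaginary parts of `iτA D = D K`, entry by entry.
  re-term : ∀ τ j w w′ p → - (seq τ j * seq (A w w′) j) * (χ⁻ w′ * p) ≡ χ⁺ w * (K τ j w w′ * p)
  re-term τ j w w′ p with χ w in χw | χ w′ in χw′
  ... | true  | true  rewrite A-bip w w′ j (trans χw (sym χw′)) = lemma (seq τ j) p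
    where
    lemma : ∀ t p → - (t * 0ℚ) * (0ℚ * p) ≡ 1ℚ * (- (t * 0ℚ) * p)
    lemma = solve-∀ ℚ-ring
  ... | true  | false = lemma (seq τ j * seq (A w w′) j) p
    where
    lemma : ∀ t p → - t * (1ℚ * p) ≡ 1ℚ * (- t * p)
    lemma = solve-∀ ℚ-ring
  ... | false | true  = lemma (seq τ j * seq (A w w′) j) p
    where
    lemma : ∀ t p → - t * (0ℚ * p) ≡ 0ℚ * (t * p)
    lemma = solve-∀ ℚ-ring
  ... | false | false rewrite A-bip w w′ j (trans χw (sym χw′)) = lemma (seq τ j) p
    where
    lemma : ∀ t p → - (t * 0ℚ) * (1ℚ * p) ≡ 0ℚ * ((t * 0ℚ) * p)
    lemma = solve-∀ ℚ-ring

  im-term : ∀ τ j w w′ p → (seq τ j * seq (A w w′) j) * (χ⁺ w′ * p) ≡ χ⁻ w * (K τ j w w′ * p)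
  im-term τ j w w′ p with χ w in χw | χ w′ in χw′
  ... | true  | true  rewrite A-bip w w′ j (trans χw (sym χw′)) = lemma (seq τ j) p
    where
    lemma : ∀ t p → (t * 0ℚ) * (1ℚ * p) ≡ 0ℚ * (- (t * 0ℚ) * p)
    lemma = solve-∀ ℚ-ring
  ... | true  | false = lemma (seq τ j * seq (A w w′) j) p
    where
    lemma : ∀ t p → t * (0ℚ * p) ≡ 0ℚ * (- t * p)
    lemma = solve-∀ ℚ-ring
  ... | false | true  = lemma (seq τ j * seq (A w w′) j) p
    where
    lemma : ∀ t p → t * (1ℚ * p) ≡ 1ℚ * (t * p)
    lemma = solve-∀ ℚ-ring
  ... | false | false rewrite A-bip w w′ j (trans χw (sym χw′)) = lemma (seq τ j) p
    where
    lemma : ∀ t p → (t * 0ℚ) * (0ℚ * p) ≡ 1ℚ * ((t * 0ℚ) * p)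
    lemma = solve-∀ ℚ-ring

  re-*ᶜ : ∀ τ j w w′ z → seq (re ((i τ • A) w w′ *ᶜ z)) j ≡ - (seq τ j * seq (A w w′) j) * seq (im z) j
  re-*ᶜ τ j w w′ z = lemma (seq τ j) (seq (A w w′) j) (seq (re z) j) (seq (im z) j)
    where
    lemma : ∀ t a x y → ((0ℚ * t - 1ℚ * 0ℚ) * a - (0ℚ * 0ℚ + 1ℚ * t) * 0ℚ) * x
                      - ((0ℚ * t - 1ℚ * 0ℚ) * 0ℚ + (0ℚ * 0ℚ + 1ℚ * t) * a) * y ≡ - (t * a) * y
    lemma = solve-∀ ℚ-ring

  im-*ᶜ : ∀ τ j w w′ z → seq (im ((i τ • A) w w′ *ᶜ z)) j ≡ (seq τ j * seq (A w w′) j) * seq (re z) j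
  im-*ᶜ τ j w w′ z = lemma (seq τ j) (seq (A w w′) j) (seq (re z) j) (seq (im z) j)
    where
    lemma : ∀ t a x y → ((0ℚ * t - 1ℚ * 0ℚ) * a - (0ℚ * 0ℚ + 1ℚ * t) * 0ℚ) * y
                      + ((0ℚ * t - 1ℚ * 0ℚ) * 0ℚ + (0ℚ * 0ℚ + 1ℚ * t) * a) * x ≡ (t * a) * x
    lemma = solve-∀ ℚ-ring

  module _ (τ : ℝ) (j : ℕ) {u : Fin n} (χu : χ u ≡ true) where

    -- Since `χ u` is true, D fixes `e_u`, and the column of `u` in `(iτA)^k` is D times the real
    -- vector `K^k e_u`. Multiplication by i exchanges the two parts, so the two inductions are
    -- intertwined.
    re-power : ∀ k w → seq (re (((i τ • A) ^ᴹ k) w u)) j ≡ χ⁺ w * power (K τ j) k w u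
    im-power : ∀ k w → seq (im (((i τ • A) ^ᴹ k) w u)) j ≡ χ⁻ w * power (K τ j) k w u

    re-power zero w with w Fin.≟ u
    ... | yes refl rewrite χu = refl
    ... | no  _    = sym (ℚ.*-zeroʳ (χ⁺ w))
    re-power (suc k) w = trans (seq-re-sumℂ (λ w′ → (i τ • A) w w′ *ᶜ ((i τ • A) ^ᴹ k) w′ u) j) (trans
      (sum-cong-≗ λ w′ → trans (re-*ᶜ τ j w w′ (((i τ • A) ^ᴹ k) w′ u))
        (trans (cong (- (seq τ j * seq (A w w′) j) *_) (im-power k w′)) (re-term τ j w w′ (power (K τ j) k w′ u))))
      (sym (*-distribˡ-sum (χ⁺ w) (λ w′ → K τ j w w′ * power (K τ j) k w′ u))))

    im-power zero w with w Fin.≟ u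
    ... | yes refl rewrite χu = refl
    ... | no  _    = sym (ℚ.*-zeroʳ (χ⁻ w))
    im-power (suc k) w = trans (seq-im-sumℂ (λ w′ → (i τ • A) w w′ *ᶜ ((i τ • A) ^ᴹ k) w′ u) j) (trans
      (sum-cong-≗ λ w′ → trans (im-*ᶜ τ j w w′ (((i τ • A) ^ᴹ k) w′ u))
        (trans (cong ((seq τ j * seq (A w w′) j) *_) (re-power k w′)) (im-term τ j w w′ (power (K τ j) k w′ u))))
      (sym (*-distribˡ-sum (χ⁻ w) (λ w′ → K τ j w w′ * power (K τ j) k w′ u))))

  expSum : ℝ → ℕ → Fin n → Fin n → ℂ
  expSum τ m w u = sumℂ {m} λ k → ofℝ (recip (toℕ k !) {{toℕ k ℕ.!≢0}}) *ᶜ ((i τ • A) ^ᴹ toℕ k) w u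

  module _ (τ : ℝ) (j m : ℕ) {u : Fin n} (χu : χ u ≡ true) (w : Fin n) where
    re-expSum : seq (re (expSum τ m w u)) j ≡ χ⁺ w * expPartial (K τ j) m w u
    re-expSum = trans (seq-re-sumℂ {m} (λ k → ofℝ (recip (toℕ k !) {{toℕ k ℕ.!≢0}}) *ᶜ ((i τ • A) ^ᴹ toℕ k) w u) j) (trans
      (sum-cong-≗ {m} (λ k → trans
        (cong (λ x → 1/ toℕ k ! * x - 0ℚ * seq (im (((i τ • A) ^ᴹ toℕ k) w u)) j) (re-power τ j χu (toℕ k) w))
        (lemma (1/ toℕ k !) (χ⁺ w) (power (K τ j) (toℕ k) w u) (seq (im (((i τ • A) ^ᴹ toℕ k) w u)) j))))
      (sym (*-distribˡ-sum {m} (χ⁺ w) (λ k → 1/ toℕ k ! * power (K τ j) (toℕ k) w u))))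
      where
      lemma : ∀ c x p y → c * (x * p) - 0ℚ * y ≡ x * (c * p)
      lemma = solve-∀ ℚ-ring

    im-expSum : seq (im (expSum τ m w u)) j ≡ χ⁻ w * expPartial (K τ j) m w u
    im-expSum = trans (seq-im-sumℂ {m} (λ k → ofℝ (recip (toℕ k !) {{toℕ k ℕ.!≢0}}) *ᶜ ((i τ • A) ^ᴹ toℕ k) w u) j) (trans
      (sum-cong-≗ {m} (λ k → trans
        (cong (λ x → 1/ toℕ k ! * x + 0ℚ * seq (re (((i τ • A) ^ᴹ toℕ k) w u)) j) (im-power τ j χu (toℕ k) w))
        (lemma (1/ toℕ k !) (χ⁻ w) (power (K τ j) (toℕ k) w u) (seq (re (((i τ • A) ^ᴹ toℕ k) w u)) j))))
      (sym (*-distribˡ-sum {m} (χ⁻ w) (λ k → 1/ toℕ k ! * power (K τ j) (toℕ k) w u))))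
      where
      lemma : ∀ c x p y → c * (x * p) + 0ℚ * y ≡ x * (c * p)
      lemma = solve-∀ ℚ-ring

  -- In each row one part follows `p` and the other is near 0; the colour of `w` decides which is
  -- which in `flat-approx`.
  flat-split : ∀ w a b p i {ε} → i ≤ 1ℚ → 0ℚ ≤ ε → ε ≤ 1ℚ →
    ∣ a - χ⁺ w * p ∣ ≤ ε → ∣ b - χ⁻ w * p ∣ ≤ ε → ∣ a * a + b * b - i ∣ ≤ ε + ε → ∣ p * p - i ∣ ≤ ι 8 * ε
  flat-split w a b p i {ε} i≤1 0≤ε ε≤1 ha hb h with χ w
  ... | true  = flat-approx a b p i i≤1 0≤ε ε≤1
    (subst (λ x → ∣ a - x ∣ ≤ ε) (ℚ.*-identityˡ p) ha)
    (subst (λ x → ∣ x ∣ ≤ ε) (p-0*q≡p b p) hb) h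
  ... | false = flat-approx b a p i i≤1 0≤ε ε≤1
    (subst (λ x → ∣ b - x ∣ ≤ ε) (ℚ.*-identityˡ p) hb)
    (subst (λ x → ∣ x ∣ ≤ ε) (p-0*q≡p a p) ha)
    (subst (λ x → ∣ x - i ∣ ≤ ε + ε) (ℚ.+-comm (a * a) (b * b)) h)

  flat-column : ∀ .{{_ : ℕ.NonZero n}} τ j m {u} → χ u ≡ true → ∀ w (z : ℂ) {ε} → 0ℚ ≤ ε → ε ≤ 1ℚ →
    ∣ seq (re z) j - seq (re (expSum τ m w u)) j ∣ ≤ ε →
    ∣ seq (im z) j - seq (im (expSum τ m w u)) j ∣ ≤ ε →
    ∣ seq (re z) j * seq (re z) j + seq (im z) j * seq (im z) j - inv n ∣ ≤ ε + ε →
    ∣ expPartial (K τ j) m w u * expPartial (K τ j) m w u - inv n ∣ ≤ ι 8 * ε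
  flat-column τ j m {u} χu w z {ε} 0≤ε ε≤1 hre him h =
    flat-split w (seq (re z) j) (seq (im z) j) (expPartial (K τ j) m w u) (inv n) (inv≤1 n) 0≤ε ε≤1
      (subst (λ x → ∣ seq (re z) j - x ∣ ≤ ε) (re-expSum τ j m χu w) hre)
      (subst (λ x → ∣ seq (im z) j - x ∣ ≤ ε) (im-expSum τ j m χu w) him) h

  module _ {ε} (0<ε : 0ℚ < ε) where

    expSum-close : ∀ τ U → U IsExpOf (i τ • A) → ∀ c → Eventually λ m → Eventually λ j → ∀ w →
      ∣ seq (re (U w c)) j - seq (re (expSum τ m w c)) j ∣ ≤ ε ×
      ∣ seq (im (U w c)) j - seq (im (expSum τ m w c)) j ∣ ≤ ε
    expSum-close τ U isExp c = Eventually-map (λ m → Eventually-∀)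
      (Eventually-∀ λ w → ⟶ᶜ-close (λ m → expSum τ m w c) (U w c) 0<ε (isExp w c))

    flat-expPartial : .{{_ : ℕ.NonZero n}} → ε ≤ 1ℚ → ∀ τ U → U IsExpOf (i τ • A) →
      ∀ {c} → χ c ≡ true → ∃[ r ] (r IsNormOf (((U ·ⱽ 𝐞 c) ∘ⱽ (conjᴹ U ·ⱽ 𝐞 c)) -ⱽ uniform) × r <ℝ fromℚ ε) →
      Eventually λ m → Eventually λ j → ∀ w →
      ∣ expPartial (K τ j) m w c * expPartial (K τ j) m w c - inv n ∣ ≤ ι 8 * ε
    flat-expPartial ε≤1 τ U isExp {c} χc (r , isNorm , r<ε) = Eventually-map
      (λ m close → Eventually-map
        (λ j (near , flat) w → flat-column τ j m χc w (U w c) (ℚ.<⇒≤ 0<ε) ε≤1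
          (proj₁ (near w)) (proj₂ (near w)) (flat w))
        (Eventually-× close (norm-small U c {r} 0<ε isNorm r<ε)))
      (expSum-close τ U isExp c)

    -- One `M` bounds `K τ j` for all late `j`, and the threshold for `m` depends on `K` only
    -- through `M`; thus `m` can be fixed before `j`.
    orthogonal-expPartial : ∀ τ {u v} → u ≢ v → Eventually λ m → Eventually λ j →
      ∣ sum (λ w → expPartial (K τ j) m w u * expPartial (K τ j) m w v) ∣ ≤ ε
    orthogonal-expPartial τ u≢v =
      let M , K≤M = K-bounded τ
      in Eventually-map
           (λ m small → Eventually-map (λ j k≤M → small (K τ j) (K-skew τ j) k≤M u≢v) K≤M)
           (expPartial-orthogonal {n} M 0<ε)

    odd⇒¬mixing′ : .{{_ : ℕ.NonZero n}} → ε ≤ 1ℚ → (1ℚ + ι n) * (ι n * (ι 8 * ε)) < 1ℚ →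
      ∀ b → n ≡ suc (b ℕ.+ b) → ∀ {u v} → χ u ≡ true → χ v ≡ true → u ≢ v → ¬ ε-UniformMixing A
    odd⇒¬mixing′ ε≤1 small b n≡1+2b {u} {v} χu χv u≢v mixing =
      let τ , U , isExp , norms = mixing (fromℚ ε) (0<fromℚ 0<ε)
      in Eventually-extract (Eventually-map
        (λ m (flatᵤ , flatᵥ , orthogonal) → Eventually-extract (Eventually-map
          (λ j (xᵤ , xᵥ , x⊥) → ¬flat-orthogonal b n≡1+2b (*-nonNeg (0≤ι 8) 0≤ε) small
            (λ w → expPartial (K τ j) m w u) (λ w → expPartial (K τ j) m w v) xᵤ xᵥ (ℚ.≤-trans x⊥ ε≤8ε))
          (Eventually-× flatᵤ (Eventually-× flatᵥ orthogonal))))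
        (Eventually-× (flat-expPartial ε≤1 τ U isExp χu (norms u))
          (Eventually-× (flat-expPartial ε≤1 τ U isExp χv (norms v)) (orthogonal-expPartial τ u≢v))))
      where
      0≤ε : 0ℚ ≤ ε
      0≤ε = ℚ.<⇒≤ 0<ε
      ε≤8ε : ε ≤ ι 8 * ε
      ε≤8ε = subst (_≤ ι 8 * ε) (ℚ.*-identityˡ ε)
        (ℚ.*-monoʳ-≤-nonNeg ε {{ℚ.nonNegative 0≤ε}} (ι-mono-≤ {1} {8} (ℕ.s≤s ℕ.z≤n)))

  odd⇒¬mixing : ∀ b → n ≡ suc (b ℕ.+ b) → ∀ {u v} → χ u ≡ true → χ v ≡ true → u ≢ v →
                ¬ ε-UniformMixing A
  odd⇒¬mixing b n≡1+2b {u} = odd⇒¬mixing′ (0<inv (suc k)) {{Fin.nonZeroIndex u}} (inv≤1 (suc k)) small b n≡1+2b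
    where
    -- The choice `ε = 1 / (k + 1)` turns the required inequality into `k / (k + 1) < 1`.
    k = suc n ℕ.* n ℕ.* 8
    small : (1ℚ + ι n) * (ι n * (ι 8 * inv (suc k))) < 1ℚ
    small = subst (_< 1ℚ) (trans
      (cong (_* inv (suc k)) (trans (ι-* (suc n ℕ.* n) 8) (cong (_* ι 8) (ι-* (suc n) n))))
      (lemma (1ℚ + ι n) (ι n) (ι 8) (inv (suc k)))) (ι*inv<1 k)
      where
      lemma : ∀ a b c d → a * b * c * d ≡ a * (b * (c * d))
      lemma = solve-∀ ℚ-ring

-- Subdivisions

seq-adjacency : ∀ X W u v j → seq (adjacencyMatrix X W u v) j ≡
  sum λ e → seq (if does (Graph.joins? X e u v) then PositiveWeights.weight W e else 0ℝ) j
seq-adjacency X W u v j =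
  seq-sumℝ (λ e → if does (Graph.joins? X e u v) then PositiveWeights.weight W e else 0ℝ) j

adjacency-sym : ∀ X W u v j → seq (adjacencyMatrix X W u v) j ≡ seq (adjacencyMatrix X W v u) j
adjacency-sym X W u v j = trans (seq-adjacency X W u v j) (trans
  (sum-cong-≗ {#E X} λ e → cong (λ c → seq (if c then PositiveWeights.weight W e else 0ℝ) j)
    (does-⇔ (mk⇔ Sum.swap Sum.swap) (Graph.joins? X e u v) (Graph.joins? X e v u)))
  (sym (seq-adjacency X W v u j)))

module _ (T : Graph) where
  open Subdivision T using (old; new; half₁; half₂)
  open Graph (S T) using (Joins; joins?)

  isOld : Fin (#V (S T)) → Bool
  isOld w = [ (λ _ → true) , (λ _ → false) ]′ (splitAt (#V T) w)

  isOld-old : ∀ u → isOld (old u) ≡ true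
  isOld-old u rewrite Fin.splitAt-↑ˡ (#V T) u (#E T) = refl

  isOld-new : ∀ e → isOld (new e) ≡ false
  isOld-new e rewrite Fin.splitAt-↑ʳ (#V T) (#E T) e = refl

  halves-differ : ∀ h → isOld (half₁ h) ≢ isOld (half₂ h)
  halves-differ (inj₁ e) rewrite isOld-old (Graph.end₁ T e) | isOld-new e = λ ()
  halves-differ (inj₂ e) rewrite isOld-old (Graph.end₂ T e) | isOld-new e = λ ()

  ¬joins : ∀ e u v → isOld u ≡ isOld v → ¬ Joins e u v
  ¬joins e u v eq (inj₁ (refl , refl)) = halves-differ (splitAt (#E T) e) eq
  ¬joins e u v eq (inj₂ (refl , refl)) = halves-differ (splitAt (#E T) e) (sym eq)

  adjacency-bip : ∀ W u v j → isOld u ≡ isOld v → seq (adjacencyMatrix (S T) W u v) j ≡ 0ℚ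
  adjacency-bip W u v j eq = trans (seq-adjacency (S T) W u v j) (sum-zero {#E (S T)} _ λ e →
    cong (λ c → seq (if c then PositiveWeights.weight W e else 0ℝ) j)
      (dec-false (joins? e u v) (¬joins e u v eq)))

theorem17 : (T : Graph) → IsTree T → 2 ℕ.≤ #V T →
    (w : PositiveWeights (S T)) →
    ¬ ε-UniformMixing (adjacencyMatrix (S T) w)
theorem17 T tree 2≤V w = Bipartite.odd⇒¬mixing (adjacencyMatrix (S T) w) (isOld T)
  (adjacency-sym (S T) w) (adjacency-bip T w) (#E T)
  (cong (ℕ._+ #E T) (EdgeCount.#V≡1+#E T tree))
  (isOld-old T u) (isOld-old T v) u≢v
  where
  -- Two old vertices provide the two columns. For a one-vertex tree U is 1 by 1 with an entry of
  -- modulus 1, and mixing does occur.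
  u = fromℕ< (ℕ.<⇒≤ 2≤V)
  v = fromℕ< 2≤V
  u≢v : Subdivision.old T u ≢ Subdivision.old T v
  u≢v eq with () ← trans (sym (Fin.toℕ-fromℕ< (ℕ.<⇒≤ 2≤V)))
    (trans (cong toℕ (Fin.↑ˡ-injective (#E T) u v eq)) (Fin.toℕ-fromℕ< 2≤V))
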